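{- Let $s_n$ denote the number of super-strong Wilf equivalence classes of $\mathcal S_n$ (so $s_1=s_2=1$, $s_3=2$), and $d_{i,n}=|\mathcal D_{i,n}|$. Then for every $n\ge 4$, $$s_n=s_{n-1}+\sum_{i=2}^{n-2} d_{i,n}\, s_{n-i}.$$
   Context: $\mathbb P^*$ is the set of finite words over the positive integers; $|w|$ is the length and $\|w\|$ the sum of letters of $w$. $\mathcal S_n$ is the set of permutations of $[n]=\{1,\ldots,n\}$ written as words. For $u,w\in\mathbb P^*$, $j$ is an embedding index of $u$ in $w$ if $j+|u|-1\le |w|$ and $u_k\le w_{j+k-1}$ for all $k\in[|u|]$; $Em(u,w)$ is the set of embedding indices. $u\sim_{ss}v$ (super-strong Wilf equivalence) if there is a bijection $f:\mathbb P^*\to\mathbb P^*$ with $|f(w)|=|w|$, $\|f(w)\|=\|w\|$ and $Em(u,w)=Em(v,f(w))$ for all $w$. A finite set $A\subset\mathbb P$ with $|A|\ge2$ is periodic if the differences of consecutive elements (in increasing order) are all equal. For $n\ge3$ and $i\in[n-2]$, $\mathcal D_{i,n}$ is the set of words $u=u_1\cdots u_i$ of $i$ distinct letters of $[n]$ such that $[n]\setminus\{u_1,\ldots,u_i\}$ is periodic and for every $j<i$ the set $[n]\setminus\{u_1,\ldots,u_j\}$ is not periodic. -}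

module Defs where

open import Data.Fin.Base using (Fin; toℕ)
open import Data.Fin.Permutation using (↔⇒≡)
open import Data.List.Base
  using (List; []; _∷_; length; lookup; map; upTo; applyUpTo; take; drop;
         zipWith; filter; cartesianProductWith)
open import Data.List.Relation.Binary.Permutation.Propositional using (_↭_)
open import Data.List.Relation.Unary.All using (All; all?)
open import Data.List.Relation.Unary.AllPairs using (AllPairs; allPairs?)
open import Data.List.Relation.Unary.Unique.Propositional using (Unique)
open import Data.Nat.Base using (ℕ; suc; _+_; _∸_; _≤_; _<_; s≤s; z≤n)
open import Data.Nat.ListAction using (sum)
import Data.Nat.Properties as ℕ
open import Data.Irrelevant using ([_])
open import Data.Product.Base using (Σ-syntax; _×_; _,_; proj₁; proj₂)
open import Data.Refinement as Refinement using (Refinement-syntax; value; _,_)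
open import Function.Bundles using (Bijection; _⤖_)
import Function.Properties.Bijection as Bij
open import Level using (0ℓ)
open import Relation.Binary.Bundles using (Setoid)
import Relation.Binary.Construct.On as On
open import Relation.Binary.Definitions using (DecidableEquality)
open import Relation.Binary.PropositionalEquality
  using (_≡_; refl; sym; trans; cong; subst; setoid)
open import Relation.Binary.Structures using (IsEquivalence)
open import Relation.Nullary.Decidable using (_×-dec_; _→-dec_; ¬?)
open import Relation.Nullary.Negation using (¬_)
open import Relation.Unary using (Decidable; Pred; _≐_)
open import Relation.Unary.Properties using (≐-refl; ≐-sym; ≐-trans)

------------------------------------------------------------------------
-- Words over the positive integers

ℙ : Set
ℙ = [ k ∈ ℕ ∣ 1 ≤ k ]

_≟_ : DecidableEquality ℙ
_≟_ = Refinement._≟_ ℕ._≟_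

open import Data.List.Membership.DecPropositional _≟_ using (_∈_; _∈?_; _∉?_)

ℙ* : Set
ℙ* = List ℙ

‖_‖ : ℙ* → ℕ
‖ w ‖ = sum (map value w)

-- The set {1, …, n}, listed in increasing order.
range : ℕ → List ℙ
range n = map (λ k → suc k , [ s≤s z≤n ]) (upTo n)

------------------------------------------------------------------------
-- Super-strong Wilf equivalence

-- Positions in words are 1-based in the definition of an embedding index:
-- k : Fin (length u) is the position suc (toℕ k).  The condition lookup-≤ says
-- u_k ≤ w_p for p = j + k - 1.
record Em (u w : ℙ*) (j : ℙ) : Set where
  field
    fits     : value j + length u ∸ 1 ≤ length w
    lookup-≤ : (k : Fin (length u)) (p : Fin (length w)) →
               suc (toℕ p) ≡ value j + suc (toℕ k) ∸ 1 →
               value (lookup u k) ≤ value (lookup w p)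

infix 4 _~ss_

record _~ss_ (u v : ℙ*) : Set where
  field
    bijection : ℙ* ⤖ ℙ*

  open Bijection bijection public using () renaming (to to f)

  field
    preserves-length : ∀ w → length (f w) ≡ length w
    preserves-norm   : ∀ w → ‖ f w ‖ ≡ ‖ w ‖
    preserves-Em     : ∀ w → Em u w ≐ Em v (f w)

~ss-isEquivalence : IsEquivalence _~ss_
~ss-isEquivalence = record { refl = ~refl ; sym = ~sym ; trans = ~trans }
  where
  open _~ss_

  ~refl : ∀ {u} → u ~ss u
  ~refl = record
    { bijection        = Bij.refl
    ; preserves-length = λ _ → refl
    ; preserves-norm   = λ _ → refl
    ; preserves-Em     = λ _ → ≐-refl
    }

  ~sym : ∀ {u v} → u ~ss v → v ~ss u
  ~sym {u} {v} e = record
    { bijection        = Bij.sym-≡ (bijection e)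
    ; preserves-length = λ w →
        trans (sym (preserves-length e (f⁻ w))) (cong length (f∘f⁻ w))
    ; preserves-norm   = λ w →
        trans (sym (preserves-norm e (f⁻ w))) (cong ‖_‖ (f∘f⁻ w))
    ; preserves-Em     = λ w →
        ≐-sym (subst (λ x → Em u (f⁻ w) ≐ Em v x) (f∘f⁻ w) (preserves-Em e (f⁻ w)))
    }
    where
    f⁻ : ℙ* → ℙ*
    f⁻ w = proj₁ (Bijection.strictlySurjective (bijection e) w)

    f∘f⁻ : ∀ w → f e (f⁻ w) ≡ w
    f∘f⁻ w = proj₂ (Bijection.strictlySurjective (bijection e) w)

  ~trans : ∀ {u v w} → u ~ss v → v ~ss w → u ~ss w
  ~trans a b = record
    { bijection        = Bij.trans (bijection a) (bijection b)
    ; preserves-length = λ x → trans (preserves-length b (f a x)) (preserves-length a x)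
    ; preserves-norm   = λ x → trans (preserves-norm b (f a x)) (preserves-norm a x)
    ; preserves-Em     = λ x → ≐-trans (preserves-Em a x) (preserves-Em b (f a x))
    }

𝒮 : ℕ → Set
𝒮 n = Σ[ w ∈ ℙ* ] w ↭ range n

𝒮/~ss : ℕ → Setoid 0ℓ 0ℓ
𝒮/~ss n = On.setoid
  record { isEquivalence = ~ss-isEquivalence } (proj₁ {B = λ w → w ↭ range n})

-- A setoid bijection onto Fin k sends two permutations to the same element
-- exactly when they are super-strongly Wilf equivalent.
NumberOfClasses : ℕ → ℕ → Set
NumberOfClasses n k = Bijection (𝒮/~ss n) (setoid (Fin k))

NumberOfClasses-unique : ∀ {n k l} →
  NumberOfClasses n k → NumberOfClasses n l → k ≡ l
NumberOfClasses-unique a b = ↔⇒≡ (Bij.⤖⇒↔ (Bij.trans (Bij.sym-≡ a) b))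

------------------------------------------------------------------------
-- Periodic sets and the sets 𝒟 i n

gaps : List ℙ → List ℕ
gaps A = zipWith _∸_ (drop 1 (map value A)) (map value A)

-- A finite set of positive integers is given by the list of its elements in
-- increasing order, so that gaps A are the differences of its consecutive
-- elements.
Periodic : List ℙ → Set
Periodic A = 2 ≤ length A × AllPairs _≡_ (gaps A)

-- The complement of the letters of u in {1, …, n}, in increasing order.
complement : ℕ → ℙ* → List ℙ
complement n u = filter (_∉? u) (range n)

𝒟 : ℕ → ℕ → Pred ℙ* 0ℓ
𝒟 i n u =
  length u ≡ i ×
  All (_∈ range n) u ×
  Unique u ×
  Periodic (complement n u) ×
  (∀ {j} → j < i → 1 ≤ j → ¬ Periodic (complement n (take j u)))

periodic? : Decidable Periodic
periodic? A = (2 ℕ.≤? length A) ×-dec allPairs? ℕ._≟_ (gaps A)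

𝒟? : ∀ i n → Decidable (𝒟 i n)
𝒟? i n u =
  (length u ℕ.≟ i) ×-dec
  all? (_∈? range n) u ×-dec
  allPairs? (λ x y → ¬? (x ≟ y)) u ×-dec
  periodic? (complement n u) ×-dec
  ℕ.allUpTo? (λ j → (1 ℕ.≤? j) →-dec ¬? (periodic? (complement n (take j u)))) i

-- All words of length i over {1, …, n}, each listed once.
words : ℕ → ℕ → List ℙ*
words ℕ.zero  n = [] ∷ []
words (suc i) n = cartesianProductWith _∷_ (range n) (words i n)

d : ℕ → ℕ → ℕ
d i n = length (filter (𝒟? i n) (words i n))

∑[_⋯_] : ℕ → ℕ → (ℕ → ℕ) → ℕ
∑[ a ⋯ b ] f = sum (applyUpTo (λ k → f (a + k)) (suc b ∸ a))

{-# OPTIONS --safe #-}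

-- Let P_i(u) be the set of positions of the letters of u that are at least i.  Among
-- the words of length N in which u embeds at all indices of J there is a least one,
-- and its norm is the sum over i of |J + P_i(u)|, up to a term that only depends on
-- N, J and |u|.  The number of words of given length and norm in which u embeds at
-- all indices of J only depends on that norm.  Hence, by inclusion–exclusion, u and v
-- are equivalent as soon as every P_i(u) is a translate of P_i(v).  Conversely, if u
-- and v are equivalent, the least norms agree for all J.  Comparing a long interval J
-- with the same interval without the reflected set c - K shows that the number of
-- pairs (i , x) with x + P_i(u) ⊆ K is the same for u and v.  For K = P_i(u) the larger
-- sets do not fit, and the smaller ones contribute equally by induction, so that
-- P_i(v) fits into P_i(u).
--
-- The classes are thus the chains [n] = P_1 ⊃ P_2 ⊃ … with |P_i| = n + 1 - i, each
-- member taken up to translation.  If S ∖ {x} and S ∖ {y} are translates of each other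
-- and x ≠ y, then S is an arithmetic progression with ends x and y.  Hence a chain is
-- determined by its class until a periodic member is reached after [n], and from a
-- progression with m terms it continues as a chain for S_m.

module Submission where

open import Defs hiding (_≟_)
open import Data.Bool.Base using (Bool; true; false)
import Data.Bool.Properties as Bool
open import Data.Fin.Base using (Fin; zero; suc; toℕ; fromℕ<)
import Data.Fin.Properties as Fin
open import Data.Irrelevant using ([_])
open import Data.List.Base
  using (List; []; _∷_; _++_; _∷ʳ_; length; lookup; map; filter; concat;
         applyUpTo; upTo; take; drop; cartesianProduct)
open import Data.List.Membership.DecPropositional Defs._≟_ using (_∈?_; _∉?_)
open import Data.List.Membership.Propositional using (_∈_; _∉_; find)
open import Data.List.Membership.Propositional.Properties
import Data.List.Properties as List
open import Data.List.Relation.Binary.Disjoint.Propositional using (Disjoint)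
import Data.List.Relation.Binary.Permutation.Propositional as Perm
open import Data.List.Relation.Binary.Permutation.Propositional
  using (_↭_; ↭-refl; ↭-reflexive; ↭-sym; ↭-trans; ↭⇒↭ₛ; prep)
import Data.List.Relation.Binary.Permutation.Propositional.Properties as Perm
import Data.List.Relation.Binary.Permutation.Setoid.Properties as PermSetoid
open import Data.List.Relation.Binary.Subset.Propositional using (_⊆_)
import Data.List.Relation.Unary.All as All
open import Data.List.Relation.Unary.All using (All; []; _∷_)
import Data.List.Relation.Unary.All.Properties as All
import Data.List.Relation.Unary.AllPairs as AllPairs
open import Data.List.Relation.Unary.AllPairs using (AllPairs; []; _∷_)
import Data.List.Relation.Unary.AllPairs.Properties as AllPairs
import Data.List.Relation.Unary.Any as Any
open import Data.List.Relation.Unary.Any using (Any; here; there)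
import Data.List.Relation.Unary.Any.Properties as Any
open import Data.List.Relation.Unary.Unique.Propositional using (Unique)
import Data.List.Relation.Unary.Unique.Propositional.Properties as Unique
open import Data.Nat.Base
  using (ℕ; zero; suc; _+_; _*_; _∸_; _⊔_; _≤_; _<_; _<ᵇ_; z≤n; s≤s; >-nonZero)
open import Data.Nat.Induction using (<-rec)
open import Data.Nat.ListAction using (sum)
import Data.Nat.Properties as ℕ
open import Data.Nat.Tactic.RingSolver using (solve-∀)
open import Data.Product.Base using (Σ-syntax; ∃-syntax; _×_; _,_; proj₁; proj₂; swap)
open import Data.Refinement using (value; _,_; value-injective)
open import Data.Sum.Base using (inj₁; inj₂; [_,_]′)
open import Function.Base using (_∘_; id)
open import Function.Bundles using (mk↔ₛ′)
open import Function.Properties.Inverse using (↔⇒⤖)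
open import Level using (Level; 0ℓ)
open import Relation.Binary.Definitions using (DecidableEquality; tri<; tri≈; tri>)
open import Relation.Binary.PropositionalEquality
  using (_≡_; _≢_; refl; sym; trans; cong; cong₂; subst; subst₂; setoid;
         module ≡-Reasoning)
open import Relation.Binary.Structures using (IsEquivalence)
open import Relation.Nullary.Decidable
  using (Dec; yes; no; does; _×-dec_; _→-dec_; ¬?; map′; decidable-stable;
         True; toWitness)
open import Relation.Nullary.Negation using (¬_; contradiction)
open import Relation.Unary using (Decidable; Pred; _≐_)

private
  variable
    ℓ ℓ′ : Level
    X Y : Set ℓ

module ~ss = IsEquivalence ~ss-isEquivalence

-- Finite lists without repetition

Unique-⊆-split : {xs ys : List X} → Unique xs → xs ⊆ ys → ∃[ zs ] ys ↭ xs ++ zs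
Unique-⊆-split {ys = ys} [] _ = ys , ↭-refl
Unique-⊆-split {xs = x ∷ xs} (x∉xs ∷ uniq) xs⊆ys
  with as , bs , refl ← ∈-∃++ (xs⊆ys (here refl)) =
  let zs , p = Unique-⊆-split uniq rest
  in zs , ↭-trans (Perm.shift x as bs) (prep x p)
  where
  rest : xs ⊆ as ++ bs
  rest z∈xs with ∈-++⁻ as (xs⊆ys (there z∈xs))
  ... | inj₁ z∈as         = ∈-++⁺ˡ z∈as
  ... | inj₂ (here refl)  = contradiction refl (All.lookup x∉xs z∈xs)
  ... | inj₂ (there z∈bs) = ∈-++⁺ʳ as z∈bs

Unique-⊆⇒length≤ : {xs ys : List X} → Unique xs → xs ⊆ ys → length xs ≤ length ys
Unique-⊆⇒length≤ {xs = xs} uniq xs⊆ys =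
  let zs , p = Unique-⊆-split uniq xs⊆ys in
  subst (length xs ≤_) (sym (trans (Perm.↭-length p) (List.length-++ xs)))
    (ℕ.m≤m+n (length xs) (length zs))

Unique-⊆⇒↭ : {xs ys : List X} → Unique xs → xs ⊆ ys → length ys ≤ length xs → xs ↭ ys
Unique-⊆⇒↭ {xs = xs} uniq xs⊆ys ys≤xs with Unique-⊆-split uniq xs⊆ys
... | [] , p     = ↭-sym (subst (_ ↭_) (List.++-identityʳ xs) p)
... | z ∷ zs , p = contradiction ys≤xs (ℕ.<⇒≱
  (subst (length xs <_) (sym (trans (Perm.↭-length p) (List.length-++ xs)))
    (ℕ.m<m+n (length xs) (s≤s z≤n))))

-- `R` is a relation rather than a function, so that images can be described by equations such as
-- `p + c ≡ q + d` without subtraction. One chosen image per entry gives a list without repetition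
-- inside `ys`.
length-injection : {xs : List X} {ys : List Y} (R : X → Y → Set ℓ) →
  (∀ {x x′ y} → x ∈ xs → x′ ∈ xs → R x y → R x′ y → x ≡ x′) →
  Unique xs → (∀ {x} → x ∈ xs → ∃[ y ] y ∈ ys × R x y) →
  length xs ≤ length ys
length-injection {ys = ys} R inj uniq image =
  let zs , len , uniq′ , pre = images _ inj uniq image
  in subst (_≤ length ys) len (Unique-⊆⇒length≤ uniq′ (proj₁ ∘ pre))
  where
  images : ∀ xs → (∀ {x x′ y} → x ∈ xs → x′ ∈ xs → R x y → R x′ y → x ≡ x′) →
    Unique xs → (∀ {x} → x ∈ xs → ∃[ y ] y ∈ ys × R x y) →
    ∃[ zs ] length zs ≡ length xs × Unique zs ×
      (∀ {z} → z ∈ zs → z ∈ ys × ∃[ x ] x ∈ xs × R x z)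
  images [] _ _ _ = [] , refl , [] , λ ()
  images (x ∷ xs) inj (x∉xs ∷ uniq) image =
    let y , y∈ys , r          = image (here refl)
        zs , len , uniq′ , pre = images xs (λ p q → inj (there p) (there q)) uniq (image ∘ there)
    in y ∷ zs , cong suc len
     , All.tabulate (λ z∈zs y≡z → let _ , x′ , x′∈xs , r′ = pre z∈zs in
         All.lookup x∉xs x′∈xs
           (inj (here refl) (there x′∈xs) r (subst (R x′) (sym y≡z) r′))) ∷ uniq′
     , λ { (here refl)  → y∈ys , x , here refl , r
         ; (there z∈zs) → let z∈ys , x′ , x′∈xs , r′ = pre z∈zs in
                          z∈ys , x′ , there x′∈xs , r′ }

# : {P : Pred X ℓ} → Decidable P → List X → ℕ
# P? xs = length (filter P? xs)

#-split : {P Q : Pred X ℓ} (P? : Decidable P) (Q? : Decidable Q) (xs : List X) →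
  # P? xs ≡ # (λ x → P? x ×-dec Q? x) xs + # (λ x → P? x ×-dec ¬? (Q? x)) xs
#-split P? Q? []       = refl
#-split P? Q? (x ∷ xs) with P? x | Q? x
... | no  _ | _     = #-split P? Q? xs
... | yes _ | yes _ = cong suc (#-split P? Q? xs)
... | yes _ | no  _ = trans (cong suc (#-split P? Q? xs)) (sym (ℕ.+-suc _ _))

#-cong : {P : Pred X ℓ} {Q : Pred X ℓ′} (P? : Decidable P) (Q? : Decidable Q) →
  P ≐ Q → ∀ xs → # P? xs ≡ # Q? xs
#-cong P? Q? P≐Q xs = cong length (List.filter-≐ P? Q? P≐Q xs)

-- Counting by the full vector of outcomes of a family of tests

module _ {X : Set ℓ} {I : Set} where

  -- `U w r` is the outcome of test `r` on `w`. Tests in `In` must succeed, those in `R` must have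
  -- the outcomes `bs`; the induction below moves tests out of `R` until only prescribed successes
  -- are left.
  Meets : (X → I → Bool) → List I → List I → List Bool → Pred X 0ℓ
  Meets U In R bs w = All (λ r → U w r ≡ true) In × map (U w) R ≡ bs

  meets? : ∀ U In R bs → Decidable (Meets U In R bs)
  meets? U In R bs w =
    All.all? (λ r → U w r Bool.≟ true) In ×-dec List.≡-dec Bool._≟_ (map (U w) R) bs

module _ {X : Set ℓ} {I : Set} (L : List X) where

  #Meets : (X → I → Bool) → List I → List I → List Bool → ℕ
  #Meets U In R bs = # (meets? U In R bs) L

  #Meets-true : ∀ U In r R bs → #Meets U In (r ∷ R) (true ∷ bs) ≡ #Meets U (r ∷ In) R bs
  #Meets-true U In r R bs =
    #-cong (meets? U In (r ∷ R) (true ∷ bs)) (meets? U (r ∷ In) R bs)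
      ((λ {w} → to {w}) , (λ {w} → from {w})) L
    where
    to : ∀ {w} → Meets U In (r ∷ R) (true ∷ bs) w → Meets U (r ∷ In) R bs w
    to (p , q) = List.∷-injectiveˡ q ∷ p , List.∷-injectiveʳ q
    from : ∀ {w} → Meets U (r ∷ In) R bs w → Meets U In (r ∷ R) (true ∷ bs) w
    from (e ∷ p , q) = p , cong₂ _∷_ e q

  #Meets-false : ∀ U In r R bs →
    #Meets U In R bs ≡ #Meets U (r ∷ In) R bs + #Meets U In (r ∷ R) (false ∷ bs)
  #Meets-false U In r R bs = trans
    (#-split (meets? U In R bs) (λ w → U w r Bool.≟ true) L)
    (cong₂ _+_
      (#-cong (λ w → meets? U In R bs w ×-dec (U w r Bool.≟ true)) (meets? U (r ∷ In) R bs)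
        ((λ {w} → to {w}) , (λ {w} → from {w})) L)
      (#-cong (λ w → meets? U In R bs w ×-dec ¬? (U w r Bool.≟ true))
        (meets? U In (r ∷ R) (false ∷ bs)) ((λ {w} → to′ {w}) , (λ {w} → from′ {w})) L))
    where
    to : ∀ {w} → Meets U In R bs w × U w r ≡ true → Meets U (r ∷ In) R bs w
    to ((p , q) , e) = e ∷ p , q
    from : ∀ {w} → Meets U (r ∷ In) R bs w → Meets U In R bs w × U w r ≡ true
    from (e ∷ p , q) = (p , q) , e
    to′ : ∀ {w} → Meets U In R bs w × U w r ≢ true → Meets U In (r ∷ R) (false ∷ bs) w
    to′ ((p , q) , e) = p , cong₂ _∷_ (Bool.¬-not e) q
    from′ : ∀ {w} → Meets U In (r ∷ R) (false ∷ bs) w → Meets U In R bs w × U w r ≢ true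
    from′ (p , q) = (p , List.∷-injectiveʳ q) , λ e →
      contradiction (trans (sym (List.∷-injectiveˡ q)) e) λ ()

  -- Inclusion–exclusion, one test at a time: failures are all minus successes.
  #Meets-cong : ∀ U V → (∀ In → #Meets U In [] [] ≡ #Meets V In [] []) →
    ∀ R In bs → #Meets U In R bs ≡ #Meets V In R bs
  #Meets-cong U V h [] In [] = h In
  #Meets-cong U V h [] In (b ∷ bs) = trans (none U) (sym (none V))
    where
    none : ∀ U → #Meets U In [] (b ∷ bs) ≡ 0
    none U = cong length (List.filter-none (meets? U In [] (b ∷ bs)) {L} (All.tabulate λ _ ()))
  #Meets-cong U V h (r ∷ R) In [] = trans (none U) (sym (none V))
    where
    none : ∀ U → #Meets U In (r ∷ R) [] ≡ 0
    none U = cong length (List.filter-none (meets? U In (r ∷ R) []) {L} (All.tabulate λ _ ()))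
  #Meets-cong U V h (r ∷ R) In (true ∷ bs) =
    trans (#Meets-true U In r R bs)
      (trans (#Meets-cong U V h R (r ∷ In) bs) (sym (#Meets-true V In r R bs)))
  #Meets-cong U V h (r ∷ R) In (false ∷ bs) = ℕ.+-cancelˡ-≡ (#Meets U (r ∷ In) R bs) _ _
    (begin
      #Meets U (r ∷ In) R bs + #Meets U In (r ∷ R) (false ∷ bs) ≡⟨ #Meets-false U In r R bs ⟨
      #Meets U In R bs                                          ≡⟨ #Meets-cong U V h R In bs ⟩
      #Meets V In R bs                                          ≡⟨ #Meets-false V In r R bs ⟩
      #Meets V (r ∷ In) R bs + #Meets V In (r ∷ R) (false ∷ bs)
        ≡⟨ cong (_+ _) (#Meets-cong U V h R (r ∷ In) bs) ⟨
      #Meets U (r ∷ In) R bs + #Meets V In (r ∷ R) (false ∷ bs) ∎)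
    where open ≡-Reasoning

-- Matching two lists of the same length position by position

module Matching {X : Set ℓ} (_≟_ : DecidableEquality X) where

  match : List X → List X → X → X
  match (x ∷ xs) (y ∷ ys) a with a ≟ x
  ... | yes _ = y
  ... | no  _ = match xs ys a
  match _ _ a = a

  -- This turns equality of two cardinalities into a bijection with an explicit inverse, the same
  -- matching read backwards.
  match-inverse : ∀ {xs ys a} → Unique xs → Unique ys → length xs ≡ length ys → a ∈ xs →
    match xs ys a ∈ ys × match ys xs (match xs ys a) ≡ a
  match-inverse {x ∷ xs} {[]} _ _ () _
  match-inverse {x ∷ xs} {y ∷ ys} {a} (x∉xs ∷ uxs) (y∉ys ∷ uys) len a∈ with a ≟ x
  ... | yes refl = here refl , back
    where
    back : match (y ∷ ys) (x ∷ xs) y ≡ x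
    back with y ≟ y
    ... | yes _ = refl
    ... | no ne = contradiction refl ne
  ... | no a≢x with a∈
  ...   | here a≡x   = contradiction a≡x a≢x
  ...   | there a∈xs = there (proj₁ ih) , back
    where
    ih : match xs ys a ∈ ys × match ys xs (match xs ys a) ≡ a
    ih = match-inverse uxs uys (ℕ.suc-injective len) a∈xs
    back : match (y ∷ ys) (x ∷ xs) (match xs ys a) ≡ a
    back with match xs ys a ≟ y
    ... | yes e = contradiction (sym e) (All.lookup y∉ys (proj₁ ih))
    ... | no  _ = proj₂ ih

-- Sums over initial segments

Sum : (ℕ → ℕ) → ℕ → ℕ
Sum f n = sum (applyUpTo f n)

Sum-cong : ∀ {f g} n → (∀ {i} → i < n → f i ≡ g i) → Sum f n ≡ Sum g n
Sum-cong zero    h = refl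
Sum-cong (suc n) h = cong₂ _+_ (h (s≤s z≤n)) (Sum-cong n (h ∘ s≤s))

Sum-mono : ∀ {f g} n → (∀ {i} → i < n → f i ≤ g i) → Sum f n ≤ Sum g n
Sum-mono zero    h = z≤n
Sum-mono (suc n) h = ℕ.+-mono-≤ (h (s≤s z≤n)) (Sum-mono n (h ∘ s≤s))

Sum-mono-< : ∀ {f g k} n → k < n → (∀ {i} → i < n → f i ≤ g i) → f k < g k → Sum f n < Sum g n
Sum-mono-< {k = zero}  (suc n) _         h lt = ℕ.+-mono-<-≤ lt (Sum-mono n (h ∘ s≤s))
Sum-mono-< {k = suc k} (suc n) (s≤s k<n) h lt =
  ℕ.+-mono-≤-< (h (s≤s z≤n)) (Sum-mono-< n k<n (h ∘ s≤s) lt)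

Sum-+ : ∀ f g n → Sum (λ i → f i + g i) n ≡ Sum f n + Sum g n
Sum-+ f g zero    = refl
Sum-+ f g (suc n) = begin
  f 0 + g 0 + Sum (λ i → f (suc i) + g (suc i)) n       ≡⟨ cong (f 0 + g 0 +_) (Sum-+ _ _ n) ⟩
  f 0 + g 0 + (Sum (f ∘ suc) n + Sum (g ∘ suc) n)       ≡⟨ +-interchange (f 0) (g 0) _ _ ⟩
  f 0 + Sum (f ∘ suc) n + (g 0 + Sum (g ∘ suc) n)       ∎
  where
  open ≡-Reasoning
  open import Algebra.Properties.CommutativeSemigroup ℕ.+-commutativeSemigroup
    using () renaming (interchange to +-interchange)

Sum-zero : ∀ n → Sum (λ _ → 0) n ≡ 0
Sum-zero zero    = refl
Sum-zero (suc n) = Sum-zero n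

#-∷ : {P : Pred X ℓ} (P? : Decidable P) (x : X) (xs : List X) →
  # P? (x ∷ []) + # P? xs ≡ # P? (x ∷ xs)
#-∷ P? x xs with P? x
... | yes _ = refl
... | no  _ = refl

Sum-indicator : ∀ {m} n → m ≤ n → Sum (λ i → # (i ℕ.<?_) (m ∷ [])) n ≡ m
Sum-indicator {zero}  n       _         = Sum-zero n
Sum-indicator {suc m} (suc n) (s≤s m≤n) =
  cong suc (trans (Sum-cong n λ {i} _ → shift i) (Sum-indicator n m≤n))
  where
  shift : ∀ i → # (suc i ℕ.<?_) (suc m ∷ []) ≡ # (i ℕ.<?_) (m ∷ [])
  shift i with i <ᵇ m
  ... | true  = refl
  ... | false = refl

-- Each `k ≤ n` is the number of `i < n` with `i < k`; exchanging the two summations counts the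
-- entries above each level.
layer-cake : ∀ n {ks} → All (_≤ n) ks → sum ks ≡ Sum (λ i → # (i ℕ.<?_) ks) n
layer-cake n [] = sym (Sum-zero n)
layer-cake n {k ∷ ks} (k≤n ∷ ks≤n) = begin
  k + sum ks
    ≡⟨ cong₂ _+_ (sym (Sum-indicator n k≤n)) (layer-cake n ks≤n) ⟩
  Sum (λ i → # (i ℕ.<?_) (k ∷ [])) n + Sum (λ i → # (i ℕ.<?_) ks) n
    ≡⟨ Sum-+ _ _ n ⟨
  Sum (λ i → # (i ℕ.<?_) (k ∷ []) + # (i ℕ.<?_) ks) n
    ≡⟨ Sum-cong n (λ {i} _ → #-∷ (i ℕ.<?_) k ks) ⟩
  Sum (λ i → # (i ℕ.<?_) (k ∷ ks)) n ∎
  where open ≡-Reasoning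

#-map : {P : Pred Y ℓ} (P? : Decidable P) (f : X → Y) (xs : List X) →
  # P? (map f xs) ≡ # (P? ∘ f) xs
#-map P? f []       = refl
#-map P? f (x ∷ xs) with P? (f x)
... | yes _ = cong suc (#-map P? f xs)
... | no  _ = #-map P? f xs

-- Words as functions of the position

letter : ℕ → ℙ
letter k = suc k , [ s≤s z≤n ]

value-suc : ∀ (x : ℙ) → value x ≡ suc (value x ∸ 1)
value-suc (zero  , [ () ])
value-suc (suc k , _) = refl

-- Letters are decreased by one, so that the extension by zero beyond the end
-- of a pattern imposes no condition on a word.
ex : ℙ* → ℕ → ℕ
ex []      _       = 0
ex (x ∷ w) zero    = value x ∸ 1
ex (x ∷ w) (suc p) = ex w p

word : (ℕ → ℕ) → ℕ → ℙ*
word h N = applyUpTo (letter ∘ h) N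

length-word : ∀ h N → length (word h N) ≡ N
length-word h N = List.length-applyUpTo (letter ∘ h) N

ex-word : ∀ h {N p} → p < N → ex (word h N) p ≡ h p
ex-word h {p = zero}  (s≤s _)   = refl
ex-word h {p = suc p} (s≤s p<N) = ex-word (h ∘ suc) p<N

ex-beyond : ∀ w {p} → length w ≤ p → ex w p ≡ 0
ex-beyond []      _         = refl
ex-beyond (x ∷ w) (s≤s w≤p) = ex-beyond w w≤p

<ex⇒<length : ∀ w {i p} → i < ex w p → p < length w
<ex⇒<length w {i} {p} i<ex with p ℕ.<? length w
... | yes p<len = p<len
... | no  p≮len = contradiction (subst (i <_) (ex-beyond w (ℕ.≮⇒≥ p≮len)) i<ex) λ ()

ex-ext : ∀ w w′ → length w ≡ length w′ → (∀ {p} → p < length w → ex w p ≡ ex w′ p) → w ≡ w′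
ex-ext []      []        _   _ = refl
ex-ext (x ∷ w) (x′ ∷ w′) len h = cong₂ _∷_
  (value-injective (trans (value-suc x) (trans (cong suc (h (s≤s z≤n))) (sym (value-suc x′)))))
  (ex-ext w w′ (ℕ.suc-injective len) (h ∘ s≤s))

norm-ex : ∀ w → ‖ w ‖ ≡ length w + Sum (ex w) (length w)
norm-ex []      = refl
norm-ex (x ∷ w) = begin
  value x + ‖ w ‖                                         ≡⟨ cong₂ _+_ (value-suc x) (norm-ex w) ⟩
  suc (ex₀ + (length w + Sum (ex w) (length w)))          ≡⟨ cong suc (ℕ.+-comm ex₀ _) ⟩
  suc (length w + Sum (ex w) (length w) + ex₀)            ≡⟨ cong suc (ℕ.+-assoc (length w) _ _) ⟩
  suc (length w + (Sum (ex w) (length w) + ex₀))          ≡⟨ cong (λ k → suc (length w + k)) (ℕ.+-comm _ ex₀) ⟩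
  suc (length w + (ex₀ + Sum (ex w) (length w)))          ∎
  where
  open ≡-Reasoning
  ex₀ = value x ∸ 1

norm-ex′ : ∀ w {N} → length w ≡ N → ‖ w ‖ ≡ N + Sum (ex w) N
norm-ex′ w refl = norm-ex w

norm-word : ∀ h N → ‖ word h N ‖ ≡ N + Sum h N
norm-word h N = trans (norm-ex′ (word h N) (length-word h N))
  (cong (N +_) (Sum-cong N (ex-word h)))

ex≤norm : ∀ w p → ex w p ≤ ‖ w ‖
ex≤norm []      p       = z≤n
ex≤norm (x ∷ w) zero    = ℕ.≤-trans (ℕ.m∸n≤m (value x) 1) (ℕ.m≤m+n (value x) _)
ex≤norm (x ∷ w) (suc p) = ℕ.≤-trans (ex≤norm w p) (ℕ.m≤n+m _ (value x))

value-lookup : ∀ (w : ℙ*) (k : Fin (length w)) → value (lookup w k) ≡ suc (ex w (toℕ k))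
value-lookup (x ∷ w) zero    = value-suc x
value-lookup (x ∷ w) (suc k) = value-lookup w k

-- Embeddings with 0-based indices

Embeds : ℙ* → ℙ* → Pred ℕ 0ℓ
Embeds u w j = j + length u ≤ length w × (∀ a → ex u a ≤ ex w (j + a))

ex≤-within : ∀ u {k : ℕ → ℕ} → (∀ {a} → a < length u → ex u a ≤ k a) → ∀ a → ex u a ≤ k a
ex≤-within u {k} h a with a ℕ.<? length u
... | yes a<u = h a<u
... | no  a≮u = subst (_≤ k a) (sym (ex-beyond u (ℕ.≮⇒≥ a≮u))) z≤n

embeds? : ∀ u w → Decidable (Embeds u w)
embeds? u w j = (j + length u ℕ.≤? length w) ×-dec
  map′ (ex≤-within u) restrict (ℕ.allUpTo? (λ a → ex u a ℕ.≤? ex w (j + a)) (length u))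
  where
  restrict : (∀ a → ex u a ≤ ex w (j + a)) → ∀ {a} → a < length u → ex u a ≤ ex w (j + a)
  restrict h _ = h _

Em⇒Embeds : ∀ {u w} k → Em u w k → Embeds u w (value k ∸ 1)
Em⇒Embeds (zero , [ () ])
Em⇒Embeds {u} {w} (suc j , _) em = Em.fits em , ex≤-within u below
  where
  below : ∀ {a} → a < length u → ex u a ≤ ex w (j + a)
  below {a} a<u = ℕ.≤-pred (begin
      suc (ex u a)          ≡⟨ cong (suc ∘ ex u) (Fin.toℕ-fromℕ< a<u) ⟨
      suc (ex u (toℕ k))    ≡⟨ value-lookup u k ⟨
      value (lookup u k)    ≤⟨ Em.lookup-≤ em k p pos ⟩
      value (lookup w p)    ≡⟨ value-lookup w p ⟩
      suc (ex w (toℕ p))    ≡⟨ cong (suc ∘ ex w) (Fin.toℕ-fromℕ< j+a<w) ⟩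
      suc (ex w (j + a))    ∎)
    where
    open ℕ.≤-Reasoning
    j+a<w : j + a < length w
    j+a<w = ℕ.<-≤-trans (ℕ.+-monoʳ-< j a<u) (Em.fits em)
    k = fromℕ< a<u
    p = fromℕ< j+a<w
    pos : suc (toℕ p) ≡ j + suc (toℕ k)
    pos = trans (cong suc (trans (Fin.toℕ-fromℕ< j+a<w) (cong (j +_) (sym (Fin.toℕ-fromℕ< a<u)))))
      (sym (ℕ.+-suc j _))

Embeds⇒Em : ∀ {u w} k → Embeds u w (value k ∸ 1) → Em u w k
Embeds⇒Em (zero , [ () ])
Embeds⇒Em {u} {w} (suc j , _) (fits , below) = record
  { fits     = fits
  ; lookup-≤ = λ k p pos → begin
      value (lookup u k)         ≡⟨ value-lookup u k ⟩
      suc (ex u (toℕ k))         ≤⟨ s≤s (below (toℕ k)) ⟩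
      suc (ex w (j + toℕ k))     ≡⟨ cong (suc ∘ ex w) (ℕ.suc-injective (trans (sym (ℕ.+-suc j _)) (sym pos))) ⟩
      suc (ex w (toℕ p))         ≡⟨ value-lookup w p ⟨
      value (lookup w p)         ∎
  }
  where open ℕ.≤-Reasoning

-- The least word in which a pattern embeds at prescribed indices

shift : ℕ → (ℕ → ℕ) → ℕ → ℕ
shift zero    g p       = g p
shift (suc j) g zero    = 0
shift (suc j) g (suc p) = shift j g p

shift-+ : ∀ j g a → shift j g (j + a) ≡ g a
shift-+ zero    g a = refl
shift-+ (suc j) g a = shift-+ j g a

<-shift⁻ : ∀ j g {i p} → i < shift j g p → ∃[ a ] p ≡ j + a × i < g a
<-shift⁻ zero    g {p = p}     lt = p , refl , lt
<-shift⁻ (suc j) g {p = suc p} lt =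
  let a , eq , lt′ = <-shift⁻ j g lt in a , cong suc eq , lt′

-- The pointwise maximum of the translates of `g` by the elements of `J`: what embeddings at all
-- indices of `J` force on each position.
cover : (ℕ → ℕ) → List ℕ → ℕ → ℕ
cover g []      p = 0
cover g (j ∷ J) p = shift j g p ⊔ cover g J p

<-cover⁻ : ∀ g J {i p} → i < cover g J p → ∃[ j ] ∃[ a ] j ∈ J × p ≡ j + a × i < g a
<-cover⁻ g (j ∷ J) {i} {p} lt with ℕ.⊔-sel (shift j g p) (cover g J p)
... | inj₁ e = let a , eq , lt′ = <-shift⁻ j g (subst (i <_) e lt)
               in j , a , here refl , eq , lt′
... | inj₂ e = let j′ , a , j′∈J , rest = <-cover⁻ g J (subst (i <_) e lt)
               in j′ , a , there j′∈J , rest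

≤-cover⁺ : ∀ g {J j} a → j ∈ J → g a ≤ cover g J (j + a)
≤-cover⁺ g {j ∷ J} a (here refl) =
  ℕ.≤-trans (ℕ.≤-reflexive (sym (shift-+ j g a))) (ℕ.m≤m⊔n (shift j g (j + a)) _)
≤-cover⁺ g {j′ ∷ J} {j} a (there j∈J) =
  ℕ.≤-trans (≤-cover⁺ g a j∈J) (ℕ.m≤n⊔m (shift j′ g (j + a)) _)

cover-least : ∀ g J (k : ℕ → ℕ) → (∀ {j} → j ∈ J → ∀ a → g a ≤ k (j + a)) → ∀ p → cover g J p ≤ k p
cover-least g J k h p with ℕ.≤-<-connex (cover g J p) (k p)
... | inj₁ le = le
... | inj₂ lt with j , a , j∈J , refl , lt′ ← <-cover⁻ g J lt = contradiction (h j∈J a) (ℕ.<⇒≱ lt′)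

Fits : ℙ* → ℕ → List ℕ → Set
Fits u N J = ∀ {j} → j ∈ J → j + length u ≤ N

leastWord : ℙ* → List ℕ → ℕ → ℙ*
leastWord u J N = word (cover (ex u) J) N

leastWord-Embeds : ∀ u {J N} → Fits u N J → ∀ {j} → j ∈ J → Embeds u (leastWord u J N) j
leastWord-Embeds u {J} {N} fits {j} j∈J =
  subst (j + length u ≤_) (sym (length-word _ N)) (fits j∈J) , ex≤-within u below
  where
  below : ∀ {a} → a < length u → ex u a ≤ ex (leastWord u J N) (j + a)
  below {a} a<u = ℕ.≤-trans (≤-cover⁺ (ex u) a j∈J)
    (ℕ.≤-reflexive (sym (ex-word (cover (ex u) J) (ℕ.<-≤-trans (ℕ.+-monoʳ-< j a<u) (fits j∈J)))))

-- Translates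

infix 4 _≼_

-- Inclusion of a translate. The shift is the integer `c - d`, kept as a pair of naturals because it
-- may be negative.
_≼_ : Pred ℕ 0ℓ → Pred ℕ 0ℓ → Set
P ≼ Q = ∃[ c ] ∃[ d ] (∀ {a} → P a → ∃[ b ] Q b × a + c ≡ b + d)

-- Since `ex` lowers letters by one, these are the positions of the letters that are at least
-- `i + 2`.
Layer : ℙ* → ℕ → Pred ℕ 0ℓ
Layer u i a = i < ex u a

-- `coverage (ex u) J N i` is the cardinality of `J + Layer u i`, provided that `u` fits into length
-- `N` at every index of `J`.
coverage : (ℕ → ℕ) → List ℕ → ℕ → ℕ → ℕ
coverage g J N i = # (λ p → i ℕ.<? cover g J p) (upTo N)

Sum-cover : ∀ u J N B → (∀ p → ex u p ≤ B) → Sum (cover (ex u) J) N ≡ Sum (coverage (ex u) J N) B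
Sum-cover u J N B ex≤B = begin
  sum (applyUpTo c N)                          ≡⟨ cong sum (List.map-upTo c N) ⟨
  sum (map c (upTo N))                         ≡⟨ layer-cake B (All.tabulate bound) ⟩
  Sum (λ i → # (i ℕ.<?_) (map c (upTo N))) B   ≡⟨ Sum-cong B (λ {i} _ → #-map (i ℕ.<?_) c (upTo N)) ⟩
  Sum (coverage (ex u) J N) B                  ∎
  where
  open ≡-Reasoning
  c = cover (ex u) J
  bound : ∀ {k} → k ∈ map c (upTo N) → k ≤ B
  bound k∈ with p , _ , refl ← ∈-map⁻ c k∈ = cover-least (ex u) J (λ _ → B) (λ _ a → ex≤B a) p

-- A shift that moves `Layer u i` into `Layer v i` also moves `J + Layer u i` into `J + Layer v i`,
-- and `fits` keeps the latter below `N`.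
coverage-≼ : ∀ u v {J N i} → Fits v N J → Layer u i ≼ Layer v i →
  coverage (ex u) J N i ≤ coverage (ex v) J N i
coverage-≼ u v {J} {N} {i} fits (c , d , move) =
  length-injection (λ p q → p + c ≡ q + d)
    (λ {p} {p′} _ _ e e′ → ℕ.+-cancelʳ-≡ c p p′ (trans e (sym e′)))
    (Unique.filter⁺ (λ p → i ℕ.<? cover (ex u) J p) (Unique.upTo⁺ N)) image
  where
  open ≡-Reasoning
  image : ∀ {p} → p ∈ filter (λ p → i ℕ.<? cover (ex u) J p) (upTo N) →
    ∃[ q ] q ∈ filter (λ p → i ℕ.<? cover (ex v) J p) (upTo N) × p + c ≡ q + d
  image p∈ with ∈-filter⁻ (λ p → i ℕ.<? cover (ex u) J p) {xs = upTo N} p∈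
  ... | _ , lt with <-cover⁻ (ex u) J lt
  ... | j , a , j∈J , refl , i<a =
    let b , i<b , eq = move i<a in
    j + b
    , ∈-filter⁺ (λ p → i ℕ.<? cover (ex v) J p)
        (∈-upTo⁺ (ℕ.<-≤-trans (ℕ.+-monoʳ-< j (<ex⇒<length v i<b)) (fits j∈J)))
        (ℕ.<-≤-trans i<b (≤-cover⁺ (ex v) b j∈J))
    , (begin
        j + a + c    ≡⟨ ℕ.+-assoc j a c ⟩
        j + (a + c)  ≡⟨ cong (j +_) eq ⟩
        j + (b + d)  ≡⟨ ℕ.+-assoc j b d ⟨
        j + b + d    ∎)

LayersTranslate : ℙ* → ℙ* → Set
LayersTranslate u v = ∀ i → Layer u i ≼ Layer v i × Layer v i ≼ Layer u i

Sum-cover-cong : ∀ u v {J N} → length u ≡ length v → LayersTranslate u v → Fits u N J →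
  Sum (cover (ex u) J) N ≡ Sum (cover (ex v) J) N
Sum-cover-cong u v {J} {N} len tr fits = begin
  Sum (cover (ex u) J) N       ≡⟨ Sum-cover u J N B (λ p → ℕ.≤-trans (ex≤norm u p) (ℕ.m≤m+n ‖ u ‖ _)) ⟩
  Sum (coverage (ex u) J N) B  ≡⟨ Sum-cong B (λ {i} _ → ℕ.≤-antisym
                                    (coverage-≼ u v fits′ (proj₁ (tr i)))
                                    (coverage-≼ v u fits (proj₂ (tr i)))) ⟩
  Sum (coverage (ex v) J N) B  ≡⟨ Sum-cover v J N B (λ p → ℕ.≤-trans (ex≤norm v p) (ℕ.m≤n+m _ ‖ u ‖)) ⟨
  Sum (cover (ex v) J) N       ∎
  where
  open ≡-Reasoning
  -- A common bound on the letters of both words, so that both sums run over the same layers.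
  B = ‖ u ‖ + ‖ v ‖
  fits′ : Fits v N J
  fits′ {j} j∈J = subst (λ k → j + k ≤ N) len (fits j∈J)

-- Enumeration of words

∈-range⁺ : ∀ {n} x → value x ≤ n → x ∈ range n
∈-range⁺ (zero  , [ () ]) _
∈-range⁺ (suc k , _) k<n = ∈-map⁺ letter (∈-upTo⁺ k<n)

∈-range⁻ : ∀ {n x} → x ∈ range n → value x ≤ n
∈-range⁻ x∈ with k , k∈ , refl ← ∈-map⁻ letter x∈ = ∈-upTo⁻ k∈

range-Unique : ∀ n → Unique (range n)
range-Unique n = Unique.map⁺ (ℕ.suc-injective ∘ cong value) (Unique.upTo⁺ n)

∈-words⁺ : ∀ {n} w → All (_∈ range n) w → w ∈ words (length w) n
∈-words⁺ []      []       = here refl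
∈-words⁺ (x ∷ w) (p ∷ ps) = ∈-cartesianProductWith⁺ _∷_ p (∈-words⁺ w ps)

∈-words⁻ : ∀ i {n w} → w ∈ words i n → length w ≡ i
∈-words⁻ zero    (here refl) = refl
∈-words⁻ (suc i) {n} w∈
  with _ , _ , _ , w′∈ , refl ← ∈-cartesianProductWith⁻ _∷_ (range n) (words i n) w∈ =
  cong suc (∈-words⁻ i w′∈)

words-Unique : ∀ i n → Unique (words i n)
words-Unique zero    n = [] ∷ []
words-Unique (suc i) n = Unique.cartesianProductWith⁺ _∷_ List.∷-injective
  (range-Unique n) (words-Unique i n)

letters≤norm : ∀ w → All (λ x → value x ≤ ‖ w ‖) w
letters≤norm []      = []
letters≤norm (x ∷ w) = ℕ.m≤m+n (value x) _ ∷
  All.map (λ le → ℕ.≤-trans le (ℕ.m≤n+m _ (value x))) (letters≤norm w)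

-- No letter of a word exceeds its norm, so an alphabet of `m` letters makes the enumeration
-- complete.
wordsOfNorm : ℕ → ℕ → List ℙ*
wordsOfNorm N m = filter (λ w → ‖ w ‖ ℕ.≟ m) (words N m)

∈-wordsOfNorm⁺ : ∀ {N m} w → length w ≡ N → ‖ w ‖ ≡ m → w ∈ wordsOfNorm N m
∈-wordsOfNorm⁺ w refl refl = ∈-filter⁺ (λ w′ → ‖ w′ ‖ ℕ.≟ ‖ w ‖)
  (∈-words⁺ w (All.map (λ {x} → ∈-range⁺ x) (letters≤norm w))) refl

∈-wordsOfNorm⁻ : ∀ N m {w} → w ∈ wordsOfNorm N m → length w ≡ N × ‖ w ‖ ≡ m
∈-wordsOfNorm⁻ N m w∈ =
  let w∈′ , norm = ∈-filter⁻ (λ w → ‖ w ‖ ℕ.≟ m) {xs = words N m} w∈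
  in ∈-words⁻ N w∈′ , norm

wordsOfNorm-Unique : ∀ N m → Unique (wordsOfNorm N m)
wordsOfNorm-Unique N m = Unique.filter⁺ (λ w → ‖ w ‖ ℕ.≟ m) (words-Unique N m)

-- From layers to super-strong Wilf equivalence

embedsᵇ : ℙ* → ℙ* → ℕ → Bool
embedsᵇ u w j = does (embeds? u w j)

does-true⁻ : {P : Set ℓ} (P? : Dec P) → does P? ≡ true → P
does-true⁻ (yes p) _ = p

does-true⁺ : {P : Set ℓ} (P? : Dec P) → P → does P? ≡ true
does-true⁺ (yes _) _ = refl
does-true⁺ (no ¬p) p = contradiction p ¬p

-- Moving the excess of a word over the least word for u to the least word for v.
#embedding-≤ : ∀ u v → length u ≡ length v → LayersTranslate u v → ∀ N m In →
  #Meets (wordsOfNorm N m) (embedsᵇ u) In [] [] ≤ #Meets (wordsOfNorm N m) (embedsᵇ v) In [] []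
#embedding-≤ u v len tr N m In =
  length-injection (λ w w′ → ∀ {p} → p < N → ex w p + cv p ≡ ex w′ p + cu p)
    (λ {w} {x} {w′} → inj {w} {x} {w′})
    (Unique.filter⁺ (meets? (embedsᵇ u) In [] []) (wordsOfNorm-Unique N m)) image
  where
  L = wordsOfNorm N m
  cu = cover (ex u) In
  cv = cover (ex v) In

  inj : ∀ {w x w′} → w ∈ filter (meets? (embedsᵇ u) In [] []) L →
    x ∈ filter (meets? (embedsᵇ u) In [] []) L →
    (∀ {p} → p < N → ex w p + cv p ≡ ex w′ p + cu p) →
    (∀ {p} → p < N → ex x p + cv p ≡ ex w′ p + cu p) → w ≡ x
  inj {w} {x} w∈ x∈ e e′ =
    let lw = proj₁ (∈-wordsOfNorm⁻ N m (proj₁ (∈-filter⁻ (meets? (embedsᵇ u) In [] []) w∈)))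
        lx = proj₁ (∈-wordsOfNorm⁻ N m (proj₁ (∈-filter⁻ (meets? (embedsᵇ u) In [] []) x∈)))
    in ex-ext w x (trans lw (sym lx)) λ {p} p<w →
         let p<N = subst (p <_) lw p<w in
         ℕ.+-cancelʳ-≡ (cv p) (ex w p) (ex x p) (trans (e p<N) (sym (e′ p<N)))

  image : ∀ {w} → w ∈ filter (meets? (embedsᵇ u) In [] []) L →
    ∃[ w′ ] w′ ∈ filter (meets? (embedsᵇ v) In [] []) L ×
      (∀ {p} → p < N → ex w p + cv p ≡ ex w′ p + cu p)
  image {w} w∈ =
    w′ , ∈-filter⁺ (meets? (embedsᵇ v) In [] []) (∈-wordsOfNorm⁺ w′ lw′ norm′)
           (All.tabulate (λ {j} j∈ → does-true⁺ (embeds? v w′ j) (embeds′ j∈)) , refl)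
       , moved
    where
    w∈⁻ = ∈-filter⁻ (meets? (embedsᵇ u) In [] []) w∈
    lw = proj₁ (∈-wordsOfNorm⁻ N m (proj₁ w∈⁻))
    norm = proj₂ (∈-wordsOfNorm⁻ N m (proj₁ w∈⁻))

    embeds : ∀ {j} → j ∈ In → Embeds u w j
    embeds {j} j∈ = does-true⁻ (embeds? u w j) (All.lookup (proj₁ (proj₂ w∈⁻)) j∈)

    fits : Fits u N In
    fits {j} j∈ = subst (j + length u ≤_) lw (proj₁ (embeds j∈))

    cu≤ : ∀ p → cu p ≤ ex w p
    cu≤ = cover-least (ex u) In (ex w) (λ j∈ → proj₂ (embeds j∈))

    h : ℕ → ℕ
    h p = ex w p ∸ cu p + cv p
    w′ = word h N
    lw′ = length-word h N

    moved : ∀ {p} → p < N → ex w p + cv p ≡ ex w′ p + cu p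
    moved {p} p<N = begin
      ex w p + cv p                   ≡⟨ cong (_+ cv p) (ℕ.m∸n+n≡m (cu≤ p)) ⟨
      ex w p ∸ cu p + cu p + cv p     ≡⟨ ℕ.+-assoc (ex w p ∸ cu p) _ _ ⟩
      ex w p ∸ cu p + (cu p + cv p)   ≡⟨ cong (ex w p ∸ cu p +_) (ℕ.+-comm (cu p) _) ⟩
      ex w p ∸ cu p + (cv p + cu p)   ≡⟨ ℕ.+-assoc (ex w p ∸ cu p) _ _ ⟨
      h p + cu p                      ≡⟨ cong (_+ cu p) (ex-word h p<N) ⟨
      ex w′ p + cu p                  ∎
      where open ≡-Reasoning

    norm′ : ‖ w′ ‖ ≡ m
    norm′ = trans (norm-ex′ w′ lw′)
      (trans (cong (N +_) (sym sums)) (trans (sym (norm-ex′ w lw)) norm))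
      where
      open ≡-Reasoning
      -- The least words for `u` and `v` have equal norms, so exchanging one for the other below `w`
      -- preserves the norm.
      sums : Sum (ex w) N ≡ Sum (ex w′) N
      sums = ℕ.+-cancelʳ-≡ (Sum cv N) _ _ (begin
        Sum (ex w) N + Sum cv N       ≡⟨ Sum-+ (ex w) cv N ⟨
        Sum (λ p → ex w p + cv p) N   ≡⟨ Sum-cong N moved ⟩
        Sum (λ p → ex w′ p + cu p) N  ≡⟨ Sum-+ (ex w′) cu N ⟩
        Sum (ex w′) N + Sum cu N      ≡⟨ cong (Sum (ex w′) N +_) (Sum-cover-cong u v len tr fits) ⟩
        Sum (ex w′) N + Sum cv N      ∎)

    embeds′ : ∀ {j} → j ∈ In → Embeds v w′ j
    embeds′ {j} j∈ = fits′ , ex≤-within v below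
      where
      fits′ : j + length v ≤ length w′
      fits′ = subst (j + length v ≤_) (sym lw′) (subst (λ k → j + k ≤ N) len (fits j∈))
      below : ∀ {a} → a < length v → ex v a ≤ ex w′ (j + a)
      below {a} a<v = begin
        ex v a           ≤⟨ ≤-cover⁺ (ex v) a j∈ ⟩
        cv (j + a)       ≤⟨ ℕ.m≤n+m _ (ex w (j + a) ∸ cu (j + a)) ⟩
        h (j + a)        ≡⟨ ex-word h (ℕ.<-≤-trans (ℕ.+-monoʳ-< j a<v)
                               (subst (j + length v ≤_) lw′ fits′)) ⟨
        ex w′ (j + a)    ∎
        where open ℕ.≤-Reasoning

-- Fibres with equal embedding data and the bijection between them

≡ℙ*-dec : DecidableEquality ℙ*
≡ℙ*-dec = List.≡-dec Defs._≟_

open Matching ≡ℙ*-dec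

Key : Set
Key = ℕ × ℕ × List Bool

-- All data that a super-strong equivalence preserves. A 0-based embedding index is at most
-- `length w`, and this value occurs for the empty pattern, whence `suc`.
key : ℙ* → ℙ* → Key
key u w = length w , ‖ w ‖ , map (embedsᵇ u w) (upTo (suc (length w)))

fibre : ℙ* → Key → List ℙ*
fibre u (N , m , bs) =
  filter (meets? (embedsᵇ u) [] (upTo (suc N)) bs) (wordsOfNorm N m)

fibre-Unique : ∀ u k → Unique (fibre u k)
fibre-Unique u (N , m , bs) =
  Unique.filter⁺ (meets? (embedsᵇ u) [] (upTo (suc N)) bs) (wordsOfNorm-Unique N m)

∈-fibre⁺ : ∀ u w → w ∈ fibre u (key u w)
∈-fibre⁺ u w = ∈-filter⁺ (meets? (embedsᵇ u) [] (upTo (suc (length w))) _)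
  (∈-wordsOfNorm⁺ w refl refl) ([] , refl)

∈-fibre⁻ : ∀ u k {w} → w ∈ fibre u k → key u w ≡ k
∈-fibre⁻ u (N , m , bs) w∈
  with ∈-filter⁻ (meets? (embedsᵇ u) [] (upTo (suc N)) bs) {xs = wordsOfNorm N m} w∈
... | w∈L , _ , refl with ∈-wordsOfNorm⁻ N m w∈L
... | refl , refl = refl

transfer : ℙ* → ℙ* → ℙ* → ℙ*
transfer u v w = match (fibre u (key u w)) (fibre v (key u w)) w

-- The image has the same key with respect to `v`, so the backward transfer looks into the same two
-- fibres and reads the matching in reverse.
transfer-inverse : ∀ u v → (∀ k → length (fibre u k) ≡ length (fibre v k)) → ∀ w →
  key v (transfer u v w) ≡ key u w × transfer v u (transfer u v w) ≡ w
transfer-inverse u v len w = keys , trans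
  (cong (λ k → match (fibre v k) (fibre u k) (transfer u v w)) keys) (proj₂ inverse)
  where
  inverse = match-inverse (fibre-Unique u (key u w)) (fibre-Unique v (key u w))
    (len (key u w)) (∈-fibre⁺ u w)
  keys : key v (transfer u v w) ≡ key u w
  keys = ∈-fibre⁻ v (key u w) (proj₁ inverse)

map-≡⁻ : {f g : X → Y} {xs : List X} {x : X} → map f xs ≡ map g xs → x ∈ xs → f x ≡ g x
map-≡⁻ {xs = _ ∷ _} e (here refl) = List.∷-injectiveˡ e
map-≡⁻ {xs = _ ∷ _} e (there x∈)  = map-≡⁻ (List.∷-injectiveʳ e) x∈

key-≡⇒Em : ∀ u v {w w′} → key v w′ ≡ key u w → ∀ {j} → Em u w j → Em v w′ j
key-≡⇒Em u v {w} {w′} keq {j} em = Embeds⇒Em j (does-true⁻ (embeds? v w′ j₀)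
  (trans (sym (map-≡⁻ bits≡ j₀∈)) (does-true⁺ (embeds? u w j₀) emb)))
  where
  j₀ = value j ∸ 1
  emb = Em⇒Embeds j em
  lens : length w′ ≡ length w
  lens = cong proj₁ keq
  j₀∈ : j₀ ∈ upTo (suc (length w))
  j₀∈ = ∈-upTo⁺ (s≤s (ℕ.≤-trans (ℕ.m≤m+n j₀ _) (proj₁ emb)))
  bits≡ : map (embedsᵇ u w) (upTo (suc (length w))) ≡ map (embedsᵇ v w′) (upTo (suc (length w)))
  bits≡ = trans (sym (cong (proj₂ ∘ proj₂) keq)) (cong (λ N → map (embedsᵇ v w′) (upTo (suc N))) lens)

-- For prescribed successes alone the counts agree by `#embedding-≤` in both directions;
-- `#Meets-cong` extends this to prescribed failures. Hence corresponding fibres have equal size and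
-- can be matched.
LayersTranslate⇒~ss : ∀ u v → length u ≡ length v → LayersTranslate u v → u ~ss v
LayersTranslate⇒~ss u v len tr = record
  { bijection        = ↔⇒⤖ (mk↔ₛ′ (transfer u v) (transfer v u) (proj₂ ∘ from) (proj₂ ∘ to))
  ; preserves-length = λ w → cong proj₁ (proj₁ (to w))
  ; preserves-norm   = λ w → cong (proj₁ ∘ proj₂) (proj₁ (to w))
  ; preserves-Em     = λ w →
      key-≡⇒Em u v (proj₁ (to w)) , key-≡⇒Em v u (sym (proj₁ (to w)))
  }
  where
  length-fibre : ∀ k → length (fibre u k) ≡ length (fibre v k)
  length-fibre (N , m , bs) = #Meets-cong (wordsOfNorm N m) (embedsᵇ u) (embedsᵇ v)
    (λ In → ℕ.≤-antisym (#embedding-≤ u v len tr N m In)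
                        (#embedding-≤ v u (sym len) (λ i → proj₂ (tr i) , proj₁ (tr i)) N m In))
    (upTo (suc N)) [] bs
  to = transfer-inverse u v length-fibre
  from = transfer-inverse v u (sym ∘ length-fibre)

-- From super-strong Wilf equivalence to layers

#-difference : {P Q : Pred X 0ℓ} (P? : Decidable P) (Q? : Decidable Q) →
  (∀ {x} → P x → Q x) → ∀ xs →
  # Q? xs ≡ # P? xs + # (λ x → Q? x ×-dec ¬? (P? x)) xs
#-difference P? Q? P⊆Q xs = trans (#-split Q? P? xs)
  (cong (_+ # (λ x → Q? x ×-dec ¬? (P? x)) xs)
    (#-cong (λ x → Q? x ×-dec P? x) P? (proj₂ , λ p → P⊆Q p , p) xs))

-- The equivalence sends the least word for `u` to a word of the same norm in which `v` embeds at
-- all of `J`, and such a word lies above the least word for `v`.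
Sum-cover-≤ : ∀ u v {J N} → u ~ss v → Fits u N J →
  Sum (cover (ex v) J) N ≤ Sum (cover (ex u) J) N
Sum-cover-≤ u v {J} {N} e fits = begin
  Sum (cover (ex v) J) N  ≤⟨ Sum-mono N (λ {p} _ → cover-least (ex v) J (ex fW) (proj₂ ∘ embeds) p) ⟩
  Sum (ex fW) N           ≡⟨ ℕ.+-cancelˡ-≡ N _ _ norms ⟩
  Sum (cover (ex u) J) N  ∎
  where
  open ℕ.≤-Reasoning
  W = leastWord u J N
  fW = _~ss_.f e W

  norms : N + Sum (ex fW) N ≡ N + Sum (cover (ex u) J) N
  norms = trans (sym (norm-ex′ fW (trans (_~ss_.preserves-length e W) (length-word _ N))))
    (trans (_~ss_.preserves-norm e W) (norm-word (cover (ex u) J) N))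

  embeds : ∀ {j} → j ∈ J → Embeds v fW j
  embeds {j} j∈J = Em⇒Embeds (letter j)
    (proj₁ (_~ss_.preserves-Em e W) (Embeds⇒Em (letter j) (leastWord-Embeds u {J} fits j∈J)))

Sum-cover-≡ : ∀ u v {J N} → length u ≡ length v → u ~ss v → Fits u N J →
  Sum (cover (ex u) J) N ≡ Sum (cover (ex v) J) N
Sum-cover-≡ u v {J} {N} len e fits = ℕ.≤-antisym
  (Sum-cover-≤ v u (~ss.sym e) (λ {j} j∈ → subst (λ k → j + k ≤ N) len (fits j∈)))
  (Sum-cover-≤ u v e fits)

-- Let W be a long interval of indices, K a layer of u and J = W ∖ (2n - K).  For
-- a layer P, the set W + P exceeds J + P by the positions p with p - P ⊆ 2n - K,
-- one for each translate of P that is contained in K.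
module FitLayer (u v : ℙ*) (len : length u ≡ length v) (i : ℕ) where

  private
    n = length u
    -- With `K` inside `[0, n)`, the removed indices `c - K` lie between `n` and `2n`. A missed
    -- position `p` then satisfies `n ≤ p < M`, so that `p - a` is in `W` for every `a < n` and the
    -- ends of `W` have no influence. The `n` added in `N` makes all of `W` fit.
    c = n + n
    M = c + n
    N = M + n

  -- Membership in `c - K`. The bound `j ≤ c` rules out larger indices, for which `c ∸ j` would be
  -- 0.
  Hit : Pred ℕ 0ℓ
  Hit j = j ≤ c × i < ex u (c ∸ j)

  hit? : Decidable Hit
  hit? j = (j ℕ.≤? c) ×-dec (i ℕ.<? ex u (c ∸ j))

  W J : List ℕ
  W = upTo M
  J = filter (λ j → ¬? (hit? j)) W

  J⊆W : ∀ {j} → j ∈ J → j ∈ W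
  J⊆W j∈J = proj₁ (∈-filter⁻ (λ j → ¬? (hit? j)) {xs = W} j∈J)

  W-fits : Fits u N W
  W-fits j∈W = ℕ.+-monoˡ-≤ n (ℕ.<⇒≤ (∈-upTo⁻ j∈W))

  J-fits : Fits u N J
  J-fits = W-fits ∘ J⊆W

  cover-J≤W : ∀ g p → cover g J p ≤ cover g W p
  cover-J≤W g = cover-least g J (cover g W) (λ j∈J a → ≤-cover⁺ g a (J⊆W j∈J))

  Missed : (ℕ → ℕ) → ℕ → Pred ℕ 0ℓ
  Missed g k p = k < cover g W p × ¬ (k < cover g J p)

  missed? : ∀ g k → Decidable (Missed g k)
  missed? g k p = (k ℕ.<? cover g W p) ×-dec ¬? (k ℕ.<? cover g J p)

  #missed : (ℕ → ℕ) → ℕ → ℕ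
  #missed g k = # (missed? g k) (upTo N)

  coverage-difference : ∀ g k → coverage g W N k ≡ coverage g J N k + #missed g k
  coverage-difference g k = #-difference (λ p → k ℕ.<? cover g J p) (λ p → k ℕ.<? cover g W p)
    (λ {p} k< → ℕ.<-≤-trans k< (cover-J≤W g p)) (upTo N)

  -- Every index `p - a` with `a` in the layer must have been removed, so `p - a = c - b` for some
  -- `b` in `K`. Thus the shift by `c - p` moves the layer into `K`.
  missed⇒≼ : ∀ {k p} → Missed (ex v) k p → Layer v k ≼ Layer u i
  missed⇒≼ {k} {p} (k<W , k≮J) with <-cover⁻ (ex v) W k<W
  ... | j₀ , a₀ , j₀∈W , refl , k<a₀ = c , p , λ {a} k<a →
    let a≤p   = ℕ.≤-trans (ℕ.<⇒≤ (v<n k<a)) (ℕ.≤-trans n≤j₀ (ℕ.m≤m+n j₀ a₀))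
        j     = p ∸ a
        j+a≡p = ℕ.m∸n+n≡m a≤p
        j∈W   = ∈-upTo⁺ (ℕ.≤-<-trans (ℕ.m∸n≤m p a) p<M)
        j≤c , i<b = hit j∈W λ j∈J →
          k≮J (ℕ.<-≤-trans k<a
            (subst (λ q → ex v a ≤ cover (ex v) J q) j+a≡p (≤-cover⁺ (ex v) a j∈J)))
    in c ∸ j , i<b , reflect a j j≤c j+a≡p
    where
    reflect : ∀ a j → j ≤ c → j + a ≡ p → a + c ≡ c ∸ j + p
    reflect a j j≤c j+a≡p = begin
      a + c              ≡⟨ cong (a +_) (ℕ.m∸n+n≡m j≤c) ⟨
      a + (c ∸ j + j)    ≡⟨ ℕ.+-comm a _ ⟩
      c ∸ j + j + a      ≡⟨ ℕ.+-assoc (c ∸ j) j a ⟩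
      c ∸ j + (j + a)    ≡⟨ cong (c ∸ j +_) j+a≡p ⟩
      c ∸ j + p          ∎
      where open ≡-Reasoning

    v<n : ∀ {a} → k < ex v a → a < n
    v<n k<a = subst (_ <_) (sym len) (<ex⇒<length v k<a)

    hit : ∀ {j} → j ∈ W → j ∉ J → Hit j
    hit {j} j∈W j∉J = decidable-stable (hit? j) (j∉J ∘ ∈-filter⁺ (λ j → ¬? (hit? j)) j∈W)

    hit₀ : Hit j₀
    hit₀ = hit j₀∈W λ j₀∈J → k≮J (ℕ.<-≤-trans k<a₀ (≤-cover⁺ (ex v) a₀ j₀∈J))

    n≤j₀ : n ≤ j₀
    n≤j₀ = ℕ.+-cancelʳ-≤ n n j₀ (begin
      n + n              ≡⟨ ℕ.m+[n∸m]≡n (proj₁ hit₀) ⟨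
      j₀ + (c ∸ j₀)      ≤⟨ ℕ.+-monoʳ-≤ j₀ (ℕ.<⇒≤ (<ex⇒<length u (proj₂ hit₀))) ⟩
      j₀ + n             ∎)
      where open ℕ.≤-Reasoning

    p<M : p < M
    p<M = ℕ.+-mono-≤-< (proj₁ hit₀) (v<n k<a₀)

  -- Position `c` belongs to the identity translate of `K`: it is reached only as `(c - b) + b` with
  -- `b` in `K`, and all these indices were removed.
  c-missed : ∀ {a} → Layer u i a → Missed (ex u) i c
  c-missed {a} i<a =
    subst (λ p → i < cover (ex u) W p) (ℕ.m∸n+n≡m a≤c) (ℕ.<-≤-trans i<a (≤-cover⁺ (ex u) a a∈W)) ,
    λ i<J → let j , b , j∈J , c≡j+b , i<b = <-cover⁻ (ex u) J i<J in
      proj₂ (∈-filter⁻ (λ j → ¬? (hit? j)) {xs = W} j∈J)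
        ( subst (j ≤_) (sym c≡j+b) (ℕ.m≤m+n j b)
        , subst (λ b → i < ex u b) (sym (trans (cong (_∸ j) c≡j+b) (ℕ.m+n∸m≡n j b))) i<b)
    where
    a<n = <ex⇒<length u i<a
    a≤c : a ≤ c
    a≤c = ℕ.≤-trans (ℕ.<⇒≤ a<n) (ℕ.m≤m+n n n)
    a∈W : c ∸ a ∈ W
    a∈W = ∈-upTo⁺ (ℕ.≤-<-trans (ℕ.m∸n≤m c a) (ℕ.m<m+n c (ℕ.≤-<-trans z≤n a<n)))

  #missed-positive : ∀ {a} → Layer u i a → 0 < #missed (ex u) i
  #missed-positive i<a = ∈-length (∈-filter⁺ (missed? (ex u) i) (∈-upTo⁺ c<N) (c-missed i<a))
    where
    c<N : c < N
    c<N = ℕ.<-≤-trans (ℕ.m<m+n c (ℕ.≤-<-trans z≤n (<ex⇒<length u i<a))) (ℕ.m≤m+n M n)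

  #missed⇒≼ : ∀ {k} → 0 < #missed (ex v) k → Layer v k ≼ Layer u i
  #missed⇒≼ {k} pos with filter (missed? (ex v) k) (upTo N) in eq
  ... | p ∷ _ = missed⇒≼ (proj₂ (∈-filter⁻ (missed? (ex v) k) {xs = upTo N}
                  (subst (p ∈_) (sym eq) (here refl))))

  #missed-≡ : ∀ k → Layer u k ≼ Layer v k → Layer v k ≼ Layer u k →
    #missed (ex u) k ≡ #missed (ex v) k
  #missed-≡ k u≼v v≼u = ℕ.+-cancelˡ-≡ (coverage (ex u) J N k) _ _ (begin
    coverage (ex u) J N k + #missed (ex u) k  ≡⟨ coverage-difference (ex u) k ⟨
    coverage (ex u) W N k                     ≡⟨ coverage-≡ W W-fits ⟩
    coverage (ex v) W N k                     ≡⟨ coverage-difference (ex v) k ⟩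
    coverage (ex v) J N k + #missed (ex v) k  ≡⟨ cong (_+ #missed (ex v) k) (coverage-≡ J J-fits) ⟨
    coverage (ex u) J N k + #missed (ex v) k  ∎)
    where
    open ≡-Reasoning
    coverage-≡ : ∀ I → Fits u N I → coverage (ex u) I N k ≡ coverage (ex v) I N k
    coverage-≡ I fits = ℕ.≤-antisym
      (coverage-≼ u v {I} (λ {j} j∈ → subst (λ m → j + m ≤ N) len (fits j∈)) u≼v)
      (coverage-≼ v u {I} fits v≼u)

  private
    B = ‖ u ‖ + ‖ v ‖

  Sum-#missed : ∀ w → (∀ p → ex w p ≤ B) →
    Sum (cover (ex w) W) N ≡ Sum (cover (ex w) J) N + Sum (#missed (ex w)) B
  Sum-#missed w ex≤B = begin
    Sum (cover (ex w) W) N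
      ≡⟨ Sum-cover w W N B ex≤B ⟩
    Sum (coverage (ex w) W N) B
      ≡⟨ Sum-cong B (λ {k} _ → coverage-difference (ex w) k) ⟩
    Sum (λ k → coverage (ex w) J N k + #missed (ex w) k) B
      ≡⟨ Sum-+ (coverage (ex w) J N) (#missed (ex w)) B ⟩
    Sum (coverage (ex w) J N) B + Sum (#missed (ex w)) B
      ≡⟨ cong (_+ Sum (#missed (ex w)) B) (Sum-cover w J N B ex≤B) ⟨
    Sum (cover (ex w) J) N + Sum (#missed (ex w)) B ∎
    where open ≡-Reasoning

  -- The total numbers of missed positions agree because the least norms for `W` and for `J` do. If
  -- `v` missed nothing at level `i`, it would miss at most as much as `u` at every level: nothing
  -- below `i` by `lower`, equally much above `i` by `upper`. At level `i` the inequality would be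
  -- strict, since `u` misses `c`.
  fit : u ~ss v → ∀ {a} → Layer u i a →
    (∀ {k} → k < i → ¬ (Layer v k ≼ Layer u i)) →
    (∀ {k} → i < k → Layer u k ≼ Layer v k × Layer v k ≼ Layer u k) →
    Layer v i ≼ Layer u i
  fit e {a} i<a lower upper with #missed (ex v) i in missed-i
  ... | suc _ = #missed⇒≼ (subst (0 <_) (sym missed-i) (s≤s z≤n))
  ... | zero  = contradiction sums (ℕ.<⇒≢ (Sum-mono-< B i<B below
                  (subst (_< #missed (ex u) i) (sym missed-i) (#missed-positive i<a))))
    where
    i<B : i < B
    i<B = ℕ.<-≤-trans i<a (ℕ.≤-trans (ex≤norm u a) (ℕ.m≤m+n ‖ u ‖ _))

    below : ∀ {k} → k < B → #missed (ex v) k ≤ #missed (ex u) k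
    below {k} _ with ℕ.<-cmp k i
    ... | tri< k<i _ _  = ℕ.≤-trans (ℕ.≮⇒≥ (lower k<i ∘ #missed⇒≼)) z≤n
    ... | tri≈ _ refl _ = ℕ.≤-trans (ℕ.≤-reflexive missed-i) z≤n
    ... | tri> _ _ i<k  = ℕ.≤-reflexive (sym (#missed-≡ k (proj₁ (upper i<k)) (proj₂ (upper i<k))))

    sums : Sum (#missed (ex v)) B ≡ Sum (#missed (ex u)) B
    sums = ℕ.+-cancelˡ-≡ (Sum (cover (ex v) J) N) _ _ (begin
      Sum (cover (ex v) J) N + Sum (#missed (ex v)) B
        ≡⟨ Sum-#missed v (λ p → ℕ.≤-trans (ex≤norm v p) (ℕ.m≤n+m _ ‖ u ‖)) ⟨
      Sum (cover (ex v) W) N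
        ≡⟨ Sum-cover-≡ u v len e W-fits ⟨
      Sum (cover (ex u) W) N
        ≡⟨ Sum-#missed u (λ p → ℕ.≤-trans (ex≤norm u p) (ℕ.m≤m+n ‖ u ‖ _)) ⟩
      Sum (cover (ex u) J) N + Sum (#missed (ex u)) B
        ≡⟨ cong (_+ Sum (#missed (ex u)) B) (Sum-cover-≡ u v len e J-fits) ⟩
      Sum (cover (ex v) J) N + Sum (#missed (ex u)) B ∎)
      where open ≡-Reasoning

-- The properties of permutations that the comparison of layers uses. They will follow from the
-- layers of both words having equal sizes that decrease strictly until they reach 0.
record Staircase (u v : ℙ*) : Set where
  field
    nonempty : ∀ i {a} → Layer u i a → ∃[ b ] Layer v i b
    no-fit   : ∀ {k i a} → k < i → Layer u i a → ¬ (Layer v k ≼ Layer u i)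

-- Induction from the highest layers, which are the smallest sets, downwards. Layers from `B` on are
-- empty; at an earlier nonempty one `fit` is applied in both directions, with all higher layers
-- already settled.
~ss⇒LayersTranslate : ∀ u v → length u ≡ length v → Staircase u v → Staircase v u →
  u ~ss v → LayersTranslate u v
~ss⇒LayersTranslate u v len su sv e i = descend B i (ℕ.m≤n+m B i)
  where
  open Staircase
  B = ‖ u ‖ + ‖ v ‖

  nonempty? : ∀ i → Dec (∃[ a ] Layer u i a)
  nonempty? i = map′ (λ (a , _ , i<a) → a , i<a) (λ (a , i<a) → a , <ex⇒<length u i<a , i<a)
    (ℕ.anyUpTo? (λ a → i ℕ.<? ex u a) (length u))

  descend : ∀ m i → B ≤ i + m → Layer u i ≼ Layer v i × Layer v i ≼ Layer u i
  descend m i B≤ with nonempty? i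
  ... | no  empty = (0 , 0 , λ {a} i<a → contradiction (a , i<a) empty) ,
                    (0 , 0 , λ i<b → contradiction (nonempty sv i i<b) empty)
  descend zero i B≤ | yes (a , i<a) = contradiction
    (ℕ.≤-trans (ex≤norm u a) (ℕ.≤-trans (ℕ.m≤m+n ‖ u ‖ _) (subst (B ≤_) (ℕ.+-identityʳ i) B≤)))
    (ℕ.<⇒≱ i<a)
  descend (suc m) i B≤ | yes (a , i<a) =
    FitLayer.fit v u (sym len) i (~ss.sym e) (proj₂ (nonempty su i i<a))
      (λ k<i → no-fit sv k<i (proj₂ (nonempty su i i<a))) (swap ∘ upper) ,
    FitLayer.fit u v len i e i<a (λ k<i → no-fit su k<i i<a) upper
    where
    upper : ∀ {k} → i < k → Layer u k ≼ Layer v k × Layer v k ≼ Layer u k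
    upper {k} i<k = descend m k
      (ℕ.≤-trans B≤ (ℕ.≤-trans (ℕ.≤-reflexive (ℕ.+-suc i m)) (ℕ.+-monoˡ-≤ m i<k)))

-- Inverse permutations

↭-Unique : ∀ {xs n} → xs ↭ range n → Unique xs
↭-Unique {xs} {n} p = resp (↭-sym p) (range-Unique n)
  where
  resp : ∀ {xs ys : ℙ*} → xs ↭ ys → Unique xs → Unique ys
  resp p = PermSetoid.Unique-resp-↭ (setoid ℙ) (↭⇒↭ₛ p)

length-range : ∀ n → length (range n) ≡ n
length-range n = trans (List.length-map letter (upTo n)) (List.length-upTo n)

↭-length-range : ∀ {xs n} → xs ↭ range n → length xs ≡ n
↭-length-range {n = n} p = trans (Perm.↭-length p) (length-range n)

letter-ex : ∀ xs {a} → a < length xs → letter (ex xs a) ∈ xs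
letter-ex (x ∷ xs) {zero}  _         = here (value-injective (sym (value-suc x)))
letter-ex (x ∷ xs) {suc a} (s≤s a<n) = there (letter-ex xs a<n)

index : ℙ* → ℙ → ℕ
index []       x = 0
index (y ∷ ys) x with x Defs.≟ y
... | yes _ = 0
... | no  _ = suc (index ys x)

index-< : ∀ {xs x} → x ∈ xs → index xs x < length xs
index-< {y ∷ ys} {x} x∈ with x Defs.≟ y | x∈
... | yes _  | _         = s≤s z≤n
... | no x≢y | here x≡y  = contradiction x≡y x≢y
... | no _   | there x∈′ = s≤s (index-< x∈′)

letter-ex-index : ∀ {xs x} → x ∈ xs → letter (ex xs (index xs x)) ≡ x
letter-ex-index {y ∷ ys} {x} x∈ with x Defs.≟ y | x∈
... | yes x≡y | _         = trans (value-injective (sym (value-suc y))) (sym x≡y)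
... | no x≢y  | here x≡y  = contradiction x≡y x≢y
... | no _    | there x∈′ = letter-ex-index x∈′

index-letter-ex : ∀ {xs a} → Unique xs → a < length xs → index xs (letter (ex xs a)) ≡ a
index-letter-ex {y ∷ ys} {a} (y∉ys ∷ uniq) a<n with letter (ex (y ∷ ys) a) Defs.≟ y
index-letter-ex {y ∷ ys} {zero}  (y∉ys ∷ uniq) a<n       | yes _  = refl
index-letter-ex {y ∷ ys} {suc a} (y∉ys ∷ uniq) (s≤s a<n) | yes eq =
  contradiction (sym eq) (All.lookup y∉ys (letter-ex ys a<n))
index-letter-ex {y ∷ ys} {zero}  (y∉ys ∷ uniq) a<n       | no ne  =
  contradiction (value-injective (sym (value-suc y))) ne
index-letter-ex {y ∷ ys} {suc a} (y∉ys ∷ uniq) (s≤s a<n) | no _   =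
  cong suc (index-letter-ex uniq a<n)

∈-drop⇒≤index : ∀ m {xs x} → Unique xs → x ∈ drop m xs → m ≤ index xs x
∈-drop⇒≤index zero    uniq x∈ = z≤n
∈-drop⇒≤index (suc m) {y ∷ ys} {x} (y∉ys ∷ uniq) x∈ with x Defs.≟ y
... | yes refl = contradiction refl (All.lookup y∉ys (drop-⊆ m ys x∈))
  where
  drop-⊆ : ∀ m (xs : ℙ*) → drop m xs ⊆ xs
  drop-⊆ m xs x∈ = subst (_ ∈_) (List.take++drop≡id m xs) (∈-++⁺ʳ (take m xs) x∈)
... | no _     = s≤s (∈-drop⇒≤index m uniq x∈)

≤index⇒∈-drop : ∀ m {xs x} → x ∈ xs → m ≤ index xs x → x ∈ drop m xs
≤index⇒∈-drop zero    x∈ _ = x∈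
≤index⇒∈-drop (suc m) {y ∷ ys} {x} x∈ le with x Defs.≟ y | x∈ | le
... | no x≢y | here x≡y  | _      = contradiction x≡y x≢y
... | no _   | there x∈′ | s≤s le = ≤index⇒∈-drop m x∈′ le

Unique-map : {f : X → Y} {xs : List X} →
  (∀ {x y} → x ∈ xs → y ∈ xs → f x ≡ f y → x ≡ y) → Unique xs → Unique (map f xs)
Unique-map inj []            = []
Unique-map inj (x∉xs ∷ uniq) =
  All.map⁺ (All.tabulate λ y∈ e → All.lookup x∉xs y∈ (inj (here refl) (there y∈) e)) ∷
  Unique-map (λ p q → inj (there p) (there q)) uniq

inv : ℕ → ℙ* → ℙ*
inv n xs = word (λ k → index xs (letter k)) n

inv-≡ : ∀ n xs → inv n xs ≡ map (letter ∘ index xs) (range n)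
inv-≡ n xs = trans (sym (List.map-upTo (λ k → letter (index xs (letter k))) n))
  (List.map-∘ (upTo n))

module _ {n xs} (p : xs ↭ range n) where

  private
    ∈xs : ∀ {x} → x ∈ range n → x ∈ xs
    ∈xs = Perm.∈-resp-↭ (↭-sym p)

  ex-< : ∀ {a} → a < n → ex xs a < n
  ex-< {a} a<n =
    ∈-range⁻ (Perm.∈-resp-↭ p (letter-ex xs (subst (a <_) (sym (↭-length-range p)) a<n)))

  inv-↭ : inv n xs ↭ range n
  inv-↭ rewrite inv-≡ n xs = Unique-⊆⇒↭ (Unique-map inj (range-Unique n)) within
    (ℕ.≤-reflexive (sym (List.length-map _ (range n))))
    where
    inj : ∀ {x y} → x ∈ range n → y ∈ range n →
      letter (index xs x) ≡ letter (index xs y) → x ≡ y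
    inj x∈ y∈ e = trans (sym (letter-ex-index (∈xs x∈)))
      (trans (cong (letter ∘ ex xs) (ℕ.suc-injective (cong value e))) (letter-ex-index (∈xs y∈)))
    within : map (letter ∘ index xs) (range n) ⊆ range n
    within z∈ with x , x∈ , refl ← ∈-map⁻ (letter ∘ index xs) z∈ =
      ∈-range⁺ (letter (index xs x)) (subst (index xs x <_) (↭-length-range p) (index-< (∈xs x∈)))

inv-inv : ∀ {n xs} → xs ↭ range n → inv n (inv n xs) ≡ xs
inv-inv {n} {xs} p = ex-ext _ _ (trans (length-word _ n) (sym (↭-length-range p))) λ {a} a<len →
  let a<n = subst (a <_) (length-word _ n) a<len in begin
  ex (inv n (inv n xs)) a
    ≡⟨ ex-word (λ k → index (inv n xs) (letter k)) a<n ⟩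
  index (inv n xs) (letter a)
    ≡⟨ cong (index (inv n xs) ∘ letter)
         (index-letter-ex (↭-Unique p) (subst (a <_) (sym (↭-length-range p)) a<n)) ⟨
  index (inv n xs) (letter (index xs (letter (ex xs a))))
    ≡⟨ cong (index (inv n xs) ∘ letter) (ex-word (λ k → index xs (letter k)) (ex-< p a<n)) ⟨
  index (inv n xs) (letter (ex (inv n xs) (ex xs a)))
    ≡⟨ index-letter-ex (↭-Unique (inv-↭ p)) (subst (ex xs a <_) (sym (length-word _ n)) (ex-< p a<n)) ⟩
  ex xs a ∎
  where open ≡-Reasoning

module _ {n t} (p : t ↭ range n) where

  Layer-inv⁺ : ∀ i {a} → letter a ∈ drop (suc i) t → Layer (inv n t) i a
  Layer-inv⁺ i {a} a∈ = subst (i <_) (sym (ex-word (λ k → index t (letter k)) a<n))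
    (∈-drop⇒≤index (suc i) (↭-Unique p) a∈)
    where
    a<n : a < n
    a<n = ∈-range⁻ (Perm.∈-resp-↭ p
      (subst (letter a ∈_) (List.take++drop≡id (suc i) t) (∈-++⁺ʳ (take (suc i) t) a∈)))

  Layer-inv⁻ : ∀ i {a} → Layer (inv n t) i a → letter a ∈ drop (suc i) t
  Layer-inv⁻ i {a} i<a = ≤index⇒∈-drop (suc i)
    (Perm.∈-resp-↭ (↭-sym p) (∈-range⁺ (letter a) a<n))
    (subst (i <_) (ex-word (λ k → index t (letter k)) a<n) i<a)
    where
    a<n : a < n
    a<n = subst (a <_) (length-word _ n) (<ex⇒<length (inv n t) i<a)

-- Translation of the suffixes of a word

-- If t is the inverse of u, then drop i t lists the positions of the letters of u
-- that are larger than i, and t ≈ t′ says that the corresponding words have the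
-- same pyramidal sequence of consecutive differences.

infix 4 _≲_ _≈_

_≲_ : ℙ* → ℙ* → Set
A ≲ B = ∃[ c ] ∃[ d ] (∀ {x} → x ∈ A → ∃[ y ] y ∈ B × value x + c ≡ value y + d)

_≈_ : ℙ* → ℙ* → Set
t ≈ t′ = ∀ i → drop i t ≲ drop i t′ × drop i t′ ≲ drop i t

⊆⇒≲ : ∀ {A B} → A ⊆ B → A ≲ B
⊆⇒≲ A⊆B = 0 , 0 , λ x∈ → _ , A⊆B x∈ , refl

≲-trans : ∀ {A B C} → A ≲ B → B ≲ C → A ≲ C
≲-trans (c , d , f) (c′ , d′ , g) = c + c′ , d′ + d , λ {x} x∈ →
  let y , y∈ , e  = f x∈
      z , z∈ , e′ = g y∈
  in z , z∈ , (begin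
    value x + (c + c′)    ≡⟨ ℕ.+-assoc (value x) c c′ ⟨
    value x + c + c′      ≡⟨ cong (_+ c′) e ⟩
    value y + d + c′      ≡⟨ ℕ.+-assoc (value y) d c′ ⟩
    value y + (d + c′)    ≡⟨ cong (value y +_) (ℕ.+-comm d c′) ⟩
    value y + (c′ + d)    ≡⟨ ℕ.+-assoc (value y) c′ d ⟨
    value y + c′ + d      ≡⟨ cong (_+ d) e′ ⟩
    value z + d′ + d      ≡⟨ ℕ.+-assoc (value z) d′ d ⟩
    value z + (d′ + d)    ∎)
  where open ≡-Reasoning

≲-length : ∀ {A B} → Unique A → A ≲ B → length A ≤ length B
≲-length uniq (c , d , f) = length-injection (λ x y → value x + c ≡ value y + d)
  (λ {x} {x′} _ _ e e′ → value-injective (ℕ.+-cancelʳ-≡ c (value x) (value x′) (trans e (sym e′))))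
  uniq f

≈-refl : ∀ {t} → t ≈ t
≈-refl i = ⊆⇒≲ id , ⊆⇒≲ id

≈-sym : ∀ {t t′} → t ≈ t′ → t′ ≈ t
≈-sym e i = swap (e i)

≈-trans : ∀ {t t′ t″} → t ≈ t′ → t′ ≈ t″ → t ≈ t″
≈-trans e e′ i = ≲-trans (proj₁ (e i)) (proj₁ (e′ i)) , ≲-trans (proj₂ (e′ i)) (proj₂ (e i))

≼⇒≲ : ∀ {n t t′} → t ↭ range n → t′ ↭ range n → ∀ k i →
  Layer (inv n t) k ≼ Layer (inv n t′) i → drop (suc k) t ≲ drop (suc i) t′
≼⇒≲ p p′ k i (c , d , f) = c , d , λ
  { {zero  , [ () ]}
  ; {suc a , _} x∈ → let b , i<b , e = f (Layer-inv⁺ p k x∈) in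
                     letter b , Layer-inv⁻ p′ i i<b , cong suc e }

≲⇒≼ : ∀ {n t t′} → t ↭ range n → t′ ↭ range n → ∀ k i →
  drop (suc k) t ≲ drop (suc i) t′ → Layer (inv n t) k ≼ Layer (inv n t′) i
≲⇒≼ {n} {t} {t′} p p′ k i (c , d , f) = c , d , λ k<a →
  let y , y∈ , e = f (Layer-inv⁻ p k k<a) in back y y∈ e
  where
  back : ∀ {a} y → y ∈ drop (suc i) t′ → suc a + c ≡ value y + d →
    ∃[ b ] Layer (inv n t′) i b × a + c ≡ b + d
  back (zero  , [ () ])
  back (suc b , _) y∈ e = b , Layer-inv⁺ p′ i y∈ , ℕ.suc-injective e

module _ {n t t′} (p : t ↭ range n) (p′ : t′ ↭ range n) where

  -- Layer `i` of either word has `n ∸ suc i` elements, and a translation is injective, so sizes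
  -- alone decide both properties.
  inv-Staircase : Staircase (inv n t) (inv n t′)
  inv-Staircase = record { nonempty = nonempty ; no-fit = no-fit }
    where
    length-suffix : ∀ {t} → t ↭ range n → ∀ m → length (drop m t) ≡ n ∸ m
    length-suffix {t} p m = trans (List.length-drop m t) (cong (_∸ m) (↭-length-range p))

    positive : ∀ i {a} → Layer (inv n t) i a → 0 < n ∸ suc i
    positive i i<a = subst (0 <_) (length-suffix p (suc i)) (∈-length (Layer-inv⁻ p i i<a))

    within : ∀ i → 0 < n ∸ suc i → suc i ≤ n
    within i pos = ℕ.≮⇒≥ λ n<i → ℕ.>⇒≢ pos (ℕ.m≤n⇒m∸n≡0 (ℕ.<⇒≤ n<i))

    nonempty : ∀ i {a} → Layer (inv n t) i a → ∃[ b ] Layer (inv n t′) i b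
    nonempty i i<a with drop (suc i) t′ in eq
    ... | [] = contradiction (trans (sym (length-suffix p′ (suc i))) (cong length eq))
                 (ℕ.>⇒≢ (positive i i<a))
    ... | x ∷ _ = value x ∸ 1 , Layer-inv⁺ p′ i (subst (letter (value x ∸ 1) ∈_) (sym eq)
                    (here (value-injective (sym (value-suc x)))))

    no-fit : ∀ {k i a} → k < i → Layer (inv n t) i a → ¬ (Layer (inv n t′) k ≼ Layer (inv n t) i)
    no-fit {k} {i} k<i i<a fits = contradiction
      (subst₂ _≤_ (length-suffix p′ (suc k)) (length-suffix p (suc i))
        (≲-length (Unique.drop⁺ (suc k) (↭-Unique p′)) (≼⇒≲ p′ p k i fits)))
      (ℕ.<⇒≱ (ℕ.∸-monoʳ-< (s≤s k<i) (within i (positive i i<a))))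

module _ {n t t′} (p : t ↭ range n) (p′ : t′ ↭ range n) where

  private
    len : length (inv n t) ≡ length (inv n t′)
    len = trans (length-word _ n) (sym (length-word _ n))

  ≈⇒~ss : t ≈ t′ → inv n t ~ss inv n t′
  ≈⇒~ss e = LayersTranslate⇒~ss (inv n t) (inv n t′) len λ i →
    ≲⇒≼ p p′ i i (proj₁ (e (suc i))) , ≲⇒≼ p′ p i i (proj₂ (e (suc i)))

  ~ss⇒≈ : inv n t ~ss inv n t′ → t ≈ t′
  -- Layer `i` corresponds to `drop (suc i)`, so `drop 0` is no layer; it has the letters `[n]` for
  -- both words.
  ~ss⇒≈ e zero    = ⊆⇒≲ (Perm.∈-resp-↭ (↭-trans p (↭-sym p′))) ,
                    ⊆⇒≲ (Perm.∈-resp-↭ (↭-trans p′ (↭-sym p)))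
  ~ss⇒≈ e (suc i) =
    let tr = ~ss⇒LayersTranslate (inv n t) (inv n t′) len
               (inv-Staircase p p′) (inv-Staircase p′ p) e i
    in ≼⇒≲ p p′ i i (proj₁ tr) , ≼⇒≲ p′ p i i (proj₂ tr)

-- Arithmetic progressions

Sorted : List ℙ → Set
Sorted = AllPairs (λ x y → value x < value y)

Progression : ℕ → ℕ → List ℙ → Set
Progression a δ S = ∀ {k} → k < length S → ex S k ≡ a + k * δ

Progression-tail : ∀ {a δ x S} → Progression a δ (x ∷ S) → Progression (a + δ) δ S
Progression-tail {a} {δ} prog k<len = trans (prog (s≤s k<len)) (sym (ℕ.+-assoc a δ _))

∈⇒ex : ∀ {S x} → x ∈ S → ∃[ k ] k < length S × ex S k ≡ value x ∸ 1
∈⇒ex (here refl) = 0 , s≤s z≤n , refl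
∈⇒ex (there x∈)  = let k , k< , e = ∈⇒ex x∈ in suc k , s≤s k< , e

Progression-∈ : ∀ {a δ S x} → Progression a δ S → x ∈ S →
  ∃[ k ] k < length S × value x ≡ suc (a + k * δ)
Progression-∈ {x = x} prog x∈ =
  let k , k< , e = ∈⇒ex x∈
  in k , k< , trans (value-suc x) (cong suc (trans (sym e) (prog k<)))

Progression-gaps : ∀ {a δ} S → Progression a δ S → All (δ ≡_) (gaps S)
Progression-gaps []          prog = []
Progression-gaps (x ∷ [])    prog = []
Progression-gaps {a} {δ} (x ∷ y ∷ S) prog = sym (begin
  value y ∸ value x
    ≡⟨ cong₂ _∸_ (value-suc y) (value-suc x) ⟩
  ex (x ∷ y ∷ S) 1 ∸ ex (x ∷ y ∷ S) 0
    ≡⟨ cong₂ _∸_ (prog {1} (s≤s (s≤s z≤n))) (prog {0} (s≤s z≤n)) ⟩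
  a + (δ + 0) ∸ (a + 0)
    ≡⟨ ℕ.[m+n]∸[m+o]≡n∸o a (δ + 0) 0 ⟩
  δ + 0
    ≡⟨ ℕ.+-identityʳ δ ⟩
  δ ∎) ∷ Progression-gaps (y ∷ S) (Progression-tail prog)
  where open ≡-Reasoning

Progression⇒Periodic : ∀ {a δ S} → 2 ≤ length S → Progression a δ S → Periodic S
Progression⇒Periodic {S = S} 2≤ prog = 2≤ , all≡ (Progression-gaps S prog)
  where
  all≡ : ∀ {δ ds} → All (δ ≡_) ds → AllPairs _≡_ ds
  all≡ []          = []
  all≡ (refl ∷ es) = es ∷ all≡ es

gaps⇒Progression : ∀ {δ} x S → Sorted (x ∷ S) → All (δ ≡_) (gaps (x ∷ S)) →
  Progression (value x ∸ 1) δ (x ∷ S)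
gaps⇒Progression x S sorted gs {zero} _ = sym (ℕ.+-identityʳ _)
gaps⇒Progression x [] sorted gs {suc k} (s≤s ())
gaps⇒Progression {δ} x (y ∷ S) ((x<y ∷ _) ∷ sorted) (e ∷ gs) {suc k} (s≤s k<) = begin
  ex (y ∷ S) k                  ≡⟨ gaps⇒Progression y S sorted gs k< ⟩
  value y ∸ 1 + k * δ           ≡⟨ cong (_+ k * δ) step ⟩
  value x ∸ 1 + δ + k * δ       ≡⟨ ℕ.+-assoc (value x ∸ 1) δ _ ⟩
  value x ∸ 1 + (δ + k * δ)     ∎
  where
  open ≡-Reasoning
  step : value y ∸ 1 ≡ value x ∸ 1 + δ
  step = ℕ.suc-injective (begin
    suc (value y ∸ 1)               ≡⟨ value-suc y ⟨
    value y                         ≡⟨ ℕ.m+[n∸m]≡n (ℕ.<⇒≤ x<y) ⟨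
    value x + (value y ∸ value x)   ≡⟨ cong₂ _+_ (value-suc x) (sym e) ⟩
    suc (value x ∸ 1 + δ)           ∎)

start step : List ℙ → ℕ
start A = ex A 0
step A = ex A 1 ∸ ex A 0

Periodic⇒Progression : ∀ {A} → Sorted A → Periodic A → 0 < step A × Progression (start A) (step A) A
Periodic⇒Progression {_ ∷ []} sorted (s≤s () , _)
Periodic⇒Progression {x ∷ y ∷ A} sorted@((x<y ∷ _) ∷ _) (_ , es ∷ _) =
  subst (0 <_) step≡ (ℕ.m<n⇒0<n∸m x<y) ,
  subst (λ δ → Progression (value x ∸ 1) δ (x ∷ y ∷ A)) step≡
    (gaps⇒Progression x (y ∷ A) sorted (refl ∷ es))
  where
  step≡ : value y ∸ value x ≡ step (x ∷ y ∷ A)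
  step≡ = cong₂ _∸_ (value-suc y) (value-suc x)

-- Sets closed under a shift except at one element

remove : ℙ → List ℙ → List ℙ
remove x = filter (λ y → ¬? (y Defs.≟ x))

Progression-∷ : ∀ {a δ x S} → value x ∸ 1 ≡ a → Progression (a + δ) δ S → Progression a δ (x ∷ S)
Progression-∷ e prog {zero}  _        = trans e (sym (ℕ.+-identityʳ _))
Progression-∷ {a} {δ} e prog {suc k} (s≤s k<) = trans (prog k<) (ℕ.+-assoc a δ _)

-- The element s + δ is the second element s₁: were it a later term s₁ + (k + 1) δ
-- of the progression, then s = s₁ + k δ ≥ s₁.

closed-up : ∀ {δ x} s S → 0 < δ → Sorted (s ∷ S) →
  (∀ {a} → a ∈ s ∷ S → a ≢ x → ∃[ b ] b ∈ s ∷ S × value a + δ ≡ value b) →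
  Progression (value s ∸ 1) δ (s ∷ S) ×
  Progression (value s ∸ 1) δ (remove x (s ∷ S)) ×
  value s ≤ value x
closed-up {δ} {x} s [] 0<δ sorted closed with s Defs.≟ x
... | yes refl = Progression-∷ refl (λ ()) ,
  subst (Progression (value s ∸ 1) δ)
    (sym (List.filter-reject (λ y → ¬? (y Defs.≟ s)) {s} {[]} (λ s≢s → s≢s refl))) (λ ()) ,
  ℕ.≤-refl
... | no s≢x with closed (here refl) s≢x
... | _ , here refl , e = contradiction e (ℕ.>⇒≢ (ℕ.m<m+n (value s) 0<δ))
closed-up {δ} {x} s (s₁ ∷ S) 0<δ (s<@(s<s₁ ∷ _) ∷ sorted) closed =
  Progression-∷ refl (subst (λ a → Progression a δ (s₁ ∷ S)) s₁≡ (proj₁ ih)) ,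
  subst (Progression (value s ∸ 1) δ) (sym (List.filter-accept (λ y → ¬? (y Defs.≟ x)) s≢x))
    (Progression-∷ refl (subst (λ a → Progression a δ (remove x (s₁ ∷ S))) s₁≡ (proj₁ (proj₂ ih)))) ,
  ℕ.<⇒≤ s<x
  where
  open ≡-Reasoning
  closed′ : ∀ {a} → a ∈ s₁ ∷ S → a ≢ x → ∃[ b ] b ∈ s₁ ∷ S × value a + δ ≡ value b
  closed′ {a} a∈ a≢x with closed (there a∈) a≢x
  ... | b , there b∈ , e    = b , b∈ , e
  ... | b , here refl , e = contradiction
    (ℕ.≤-trans (ℕ.m≤m+n (value a) δ) (ℕ.≤-reflexive e)) (ℕ.<⇒≱ (All.lookup s< a∈))

  ih = closed-up s₁ S 0<δ sorted closed′

  -- By induction the exceptional element `x` is not smaller than `s₁`, so it is not the head, and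
  -- the head has a successor in the set.
  s<x : value s < value x
  s<x = ℕ.<-≤-trans s<s₁ (proj₂ (proj₂ ih))

  s≢x : s ≢ x
  s≢x refl = ℕ.n≮n (value s) s<x

  s₁≡ : value s₁ ∸ 1 ≡ value s ∸ 1 + δ
  s₁≡ with closed (here refl) s≢x
  ... | b , here refl , e = contradiction e (ℕ.>⇒≢ (ℕ.m<m+n (value s) 0<δ))
  ... | b , there b∈ , e with Progression-∈ (proj₁ ih) b∈
  ... | zero  , _ , e′ = ℕ.suc-injective (begin
    suc (value s₁ ∸ 1)       ≡⟨ cong suc (ℕ.+-identityʳ _) ⟨
    suc (value s₁ ∸ 1 + 0)   ≡⟨ e′ ⟨
    value b                  ≡⟨ e ⟨
    value s + δ              ≡⟨ cong (_+ δ) (value-suc s) ⟩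
    suc (value s ∸ 1 + δ)    ∎)
  ... | suc k , _ , e′ = contradiction s<s₁ (ℕ.≤⇒≯
    (subst (value s₁ ≤_) (sym s≡) (ℕ.m≤m+n (value s₁) (k * δ))))
    where
    s≡ : value s ≡ value s₁ + k * δ
    s≡ = ℕ.+-cancelʳ-≡ δ _ _ (begin
      value s + δ                       ≡⟨ e ⟩
      value b                           ≡⟨ e′ ⟩
      suc (value s₁ ∸ 1) + (δ + k * δ)  ≡⟨ cong₂ _+_ (sym (value-suc s₁)) (ℕ.+-comm δ _) ⟩
      value s₁ + (k * δ + δ)            ≡⟨ ℕ.+-assoc (value s₁) _ δ ⟨
      value s₁ + k * δ + δ              ∎)

-- The least element has no predecessor, so it is `x`. The second element can only have `s` as
-- predecessor, and it takes the role of the exceptional element in the tail.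
closed-down : ∀ {δ x} s S → 0 < δ → Sorted (s ∷ S) →
  (∀ {a} → a ∈ s ∷ S → a ≢ x → ∃[ b ] b ∈ s ∷ S × value a ≡ value b + δ) →
  Progression (value s ∸ 1) δ (s ∷ S) × Progression (value s ∸ 1 + δ) δ (remove x (s ∷ S))
closed-down {δ} {x} s S 0<δ (s< ∷ sorted) closed =
  whole , subst (Progression (value s ∸ 1 + δ) δ) (sym remove≡) (Progression-tail whole)
  where
  whole : Progression (value s ∸ 1) δ (s ∷ S)

  x≡s : x ≡ s
  x≡s with s Defs.≟ x
  ... | yes s≡x = sym s≡x
  ... | no  s≢x with closed (here refl) s≢x
  ... | b , here refl , e = contradiction e (ℕ.<⇒≢ (ℕ.m<m+n (value s) 0<δ))
  ... | b , there b∈ , e = contradiction (All.lookup s< b∈)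
    (ℕ.≤⇒≯ (subst (value b ≤_) (sym e) (ℕ.m≤m+n (value b) δ)))

  remove≡ : remove x (s ∷ S) ≡ S
  remove≡ = trans
    (List.filter-reject (λ y → ¬? (y Defs.≟ x)) (λ s≢x → s≢x (sym x≡s)))
    (List.filter-all (λ y → ¬? (y Defs.≟ x))
      (All.map (λ s<y y≡x → ℕ.<⇒≢ s<y (cong value (sym (trans y≡x x≡s)))) s<))

  whole = Progression-∷ refl (rest S s< sorted closed)
    where
    rest : ∀ S → All (λ y → value s < value y) S → Sorted S →
      (∀ {a} → a ∈ s ∷ S → a ≢ x → ∃[ b ] b ∈ s ∷ S × value a ≡ value b + δ) →
      Progression (value s ∸ 1 + δ) δ S
    rest [] _ _ _ ()
    rest (s₁ ∷ S) (s<s₁ ∷ s<) (s₁< ∷ sorted) closed =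
      subst (λ a → Progression a δ (s₁ ∷ S)) s₁≡′ (proj₁ (closed-down s₁ S 0<δ (s₁< ∷ sorted) closed′))
      where
      s₁≢x : s₁ ≢ x
      s₁≢x e = ℕ.<⇒≢ s<s₁ (cong value (sym (trans e x≡s)))

      s₁≡ : value s₁ ≡ value s + δ
      s₁≡ with closed (there (here refl)) s₁≢x
      ... | b , here refl , e = e
      ... | b , there (here refl) , e = contradiction e (ℕ.<⇒≢ (ℕ.m<m+n (value s₁) 0<δ))
      ... | b , there (there b∈) , e = contradiction (All.lookup s₁< b∈)
        (ℕ.≤⇒≯ (subst (value b ≤_) (sym e) (ℕ.m≤m+n (value b) δ)))

      s₁≡′ : value s₁ ∸ 1 ≡ value s ∸ 1 + δ
      s₁≡′ = cong (_∸ 1) (trans s₁≡ (cong (_+ δ) (value-suc s)))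

      closed′ : ∀ {a} → a ∈ s₁ ∷ S → a ≢ s₁ → ∃[ b ] b ∈ s₁ ∷ S × value a ≡ value b + δ
      closed′ {a} a∈ a≢s₁ with closed (there a∈) (λ a≡x →
        ℕ.<⇒≢ (All.lookup (s<s₁ ∷ s<) a∈) (cong value (sym (trans a≡x x≡s))))
      ... | b , there b∈ , e    = b , b∈ , e
      ... | b , here refl , e = contradiction (value-injective (trans e (sym s₁≡))) a≢s₁

-- The shift taking S∖x into S∖y is not zero since y is only in the first set.
≲-remove : ∀ {x y S} → Sorted S → y ∈ S → x ≢ y → remove x S ≲ remove y S →
  ∃[ δ ] ∃[ a ] ∃[ b ] Progression a δ S × Progression b δ (remove x S)
≲-remove {x} {y} {s ∷ S} sorted y∈ x≢y (c , d , f) with ℕ.<-cmp c d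
... | tri≈ _ refl _ =
  let b , b∈ , e = f (∈-filter⁺ (λ z → ¬? (z Defs.≟ x)) y∈ (x≢y ∘ sym))
  in contradiction (value-injective (sym (ℕ.+-cancelʳ-≡ c (value y) (value b) e)))
       (proj₂ (∈-filter⁻ (λ z → ¬? (z Defs.≟ y)) {xs = s ∷ S} b∈))
... | tri< c<d _ _ =
  _ , _ , _ , closed-down s S (ℕ.m<n⇒0<n∸m c<d) sorted closed
  where
  closed : ∀ {a} → a ∈ s ∷ S → a ≢ x → ∃[ b ] b ∈ s ∷ S × value a ≡ value b + (d ∸ c)
  closed {a} a∈ a≢x with f (∈-filter⁺ (λ z → ¬? (z Defs.≟ x)) a∈ a≢x)
  ... | b , b∈ , e = b , proj₁ (∈-filter⁻ (λ z → ¬? (z Defs.≟ y)) {xs = s ∷ S} b∈) ,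
    ℕ.+-cancelʳ-≡ c (value a) (value b + (d ∸ c)) (trans e (trans
      (cong (value b +_) (sym (ℕ.m∸n+n≡m (ℕ.<⇒≤ c<d)))) (sym (ℕ.+-assoc (value b) (d ∸ c) c))))
... | tri> _ _ d<c =
  let prog , prog′ , _ = closed-up s S (ℕ.m<n⇒0<n∸m d<c) sorted closed
  in _ , _ , _ , prog , prog′
  where
  closed : ∀ {a} → a ∈ s ∷ S → a ≢ x → ∃[ b ] b ∈ s ∷ S × value a + (c ∸ d) ≡ value b
  closed {a} a∈ a≢x with f (∈-filter⁺ (λ z → ¬? (z Defs.≟ x)) a∈ a≢x)
  ... | b , b∈ , e = b , proj₁ (∈-filter⁻ (λ z → ¬? (z Defs.≟ y)) {xs = s ∷ S} b∈) ,
    ℕ.+-cancelʳ-≡ d (value a + (c ∸ d)) (value b) (trans (ℕ.+-assoc (value a) (c ∸ d) d)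
      (trans (cong (value a +_) (ℕ.m∸n+n≡m (ℕ.<⇒≤ d<c))) e))

-- Complements

range-Sorted : ∀ n → Sorted (range n)
range-Sorted n = AllPairs.map⁺ (AllPairs.applyUpTo⁺₁ id n (λ i<j _ → s≤s i<j))

complement-Sorted : ∀ n u → Sorted (complement n u)
complement-Sorted n u = AllPairs.filter⁺ (_∉? u) (range-Sorted n)

drop-++ : ∀ (w : ℙ*) {s} i → drop (length w + i) (w ++ s) ≡ drop i s
drop-++ []      i = refl
drop-++ (x ∷ w) i = drop-++ w i

take-++ : ∀ (w : ℙ*) {s} → take (length w) (w ++ s) ≡ w
take-++ []      = refl
take-++ (x ∷ w) = cong (x ∷_) (take-++ w)

++-cancelˡ-↭ : ∀ (w : ℙ*) {s s′} → w ++ s ↭ w ++ s′ → s ↭ s′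
++-cancelˡ-↭ []      p = p
++-cancelˡ-↭ (x ∷ w) p = ++-cancelˡ-↭ w (Perm.drop-∷ p)

++-complement : ∀ {n u} → Unique u → All (_∈ range n) u → u ++ complement n u ↭ range n
++-complement {n} {u} uniq within = ↭-sym (Unique-⊆⇒↭ (range-Unique n) covers
  (Unique-⊆⇒length≤ (Unique.++⁺ uniq (Unique.filter⁺ (_∉? u) (range-Unique n)) disjoint) inside))
  where
  covers : range n ⊆ u ++ complement n u
  covers {x} x∈ with x ∉? u
  ... | yes x∉u  = ∈-++⁺ʳ u (∈-filter⁺ (_∉? u) x∈ x∉u)
  ... | no ¬x∉u  = ∈-++⁺ˡ (decidable-stable (x ∈? u) ¬x∉u)
  disjoint : ∀ {x} → ¬ (x ∈ u × x ∈ complement n u)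
  disjoint (x∈u , x∈c) = proj₂ (∈-filter⁻ (_∉? u) {xs = range n} x∈c) x∈u
  inside : u ++ complement n u ⊆ range n
  inside x∈ with ∈-++⁻ u x∈
  ... | inj₁ x∈u = All.lookup within x∈u
  ... | inj₂ x∈c = proj₁ (∈-filter⁻ (_∉? u) {xs = range n} x∈c)

↭-prefix : ∀ {n} w {s} → w ++ s ↭ range n → Unique w × All (_∈ range n) w
↭-prefix w p =
  subst Unique (take-++ w) (AllPairs.take⁺ (length w) (↭-Unique p)) ,
  All.tabulate (λ x∈w → Perm.∈-resp-↭ p (∈-++⁺ˡ x∈w))

↭-complement : ∀ {n} w {s} → w ++ s ↭ range n → s ↭ complement n w
↭-complement w p = let uniq , within = ↭-prefix w p in
  ++-cancelˡ-↭ w (↭-trans p (↭-sym (++-complement uniq within)))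

filter-filter : {P Q R : Pred X 0ℓ} (P? : Decidable P) (Q? : Decidable Q) (R? : Decidable R) →
  (∀ {x} → R x → P x × Q x) → (∀ {x} → P x → Q x → R x) →
  ∀ xs → filter R? xs ≡ filter Q? (filter P? xs)
filter-filter P? Q? R? to from []       = refl
filter-filter P? Q? R? to from (x ∷ xs) with ih ← filter-filter P? Q? R? to from xs | R? x | P? x
... | yes r | yes p = trans (cong (x ∷_) ih) (sym (List.filter-accept Q? (proj₂ (to r))))
... | yes r | no ¬p = contradiction (proj₁ (to r)) ¬p
... | no ¬r | no  _ = ih
... | no ¬r | yes p = trans ih (sym (List.filter-reject Q? (¬r ∘ from p)))

complement-∷ʳ : ∀ n w x → complement n (w ∷ʳ x) ≡ remove x (complement n w)
complement-∷ʳ n w x = filter-filter (_∉? w) (λ y → ¬? (y Defs.≟ x)) (_∉? (w ∷ʳ x))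
  (λ y∉ → y∉ ∘ ∈-++⁺ˡ , λ { refl → y∉ (∈-++⁺ʳ w (here refl)) })
  (λ y∉w y≢x y∈ → [ y∉w , (λ { (here y≡x) → y≢x y≡x }) ]′ (∈-++⁻ w y∈))
  (range n)

-- Prefixes ending at the first periodic complement

𝒟-minimal : ∀ {i n w y v} → 𝒟 i n (w ++ y ∷ v) → 1 ≤ length w → ¬ Periodic (complement n w)
𝒟-minimal {n = n} {w} {y} {v} (refl , _ , _ , _ , min) 1≤ =
  subst (λ w → ¬ Periodic (complement n w)) (take-++ w)
    (min (subst (length w <_) (sym (List.length-++ w)) (ℕ.m<m+n (length w) (s≤s z≤n))) 1≤)

module _ {n i i′ u u′ z z′}
  (D : 𝒟 i n u) (D′ : 𝒟 i′ n u′) (p : u ++ z ↭ range n) (p′ : u′ ++ z′ ↭ range n)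
  (norm : length u ≡ 1 → u ≡ letter 0 ∷ []) (norm′ : length u′ ≡ 1 → u′ ≡ letter 0 ∷ [])
  (1≤u : 1 ≤ length u) (1≤u′ : 1 ≤ length u′) (e : u ++ z ≈ u′ ++ z′)
  where

  private
    2≤∣_∣ : ∀ {i u z} → 𝒟 i n u → u ++ z ↭ range n → 2 ≤ length z
    2≤∣_∣ {u = u} (_ , _ , _ , per , _) p =
      subst (2 ≤_) (sym (Perm.↭-length (↭-complement u p))) (proj₁ per)

    suffix-≲ : ∀ w {x v y v′} → u ≡ w ++ x ∷ v → u′ ≡ w ++ y ∷ v′ →
      remove x (complement n w) ≲ remove y (complement n w) ×
      remove y (complement n w) ≲ remove x (complement n w)
    suffix-≲ w {x} {v} {y} {v′} refl refl =
      ≲-trans (⊆⇒≲ (Perm.∈-resp-↭ (↭-sym q))) (≲-trans (proj₁ (e k)) (⊆⇒≲ (Perm.∈-resp-↭ q′))) ,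
      ≲-trans (⊆⇒≲ (Perm.∈-resp-↭ (↭-sym q′))) (≲-trans (proj₂ (e k)) (⊆⇒≲ (Perm.∈-resp-↭ q)))
      where
      k = length w + 1
      suffix : ∀ {x v z} → (w ++ x ∷ v) ++ z ↭ range n →
        drop k ((w ++ x ∷ v) ++ z) ↭ remove x (complement n w)
      suffix {x} {v} {z} p = ↭-trans (↭-reflexive shape)
        (↭-trans (↭-complement (w ∷ʳ x) (↭-trans (↭-reflexive regroup) p))
          (↭-reflexive (complement-∷ʳ n w x)))
        where
        shape : drop k ((w ++ x ∷ v) ++ z) ≡ v ++ z
        shape = trans (cong (drop k) (List.++-assoc w (x ∷ v) z)) (drop-++ w 1)
        regroup : (w ∷ʳ x) ++ (v ++ z) ≡ (w ++ x ∷ v) ++ z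
        regroup = trans (List.∷ʳ-++ w x (v ++ z)) (sym (List.++-assoc w (x ∷ v) z))
      q = suffix p
      q′ = suffix p′

  -- `w` is the part found to be common so far. If the next letters `x` and `y` differ, the
  -- complement `S` of `w` and the set `S` without `x` are progressions by `≲-remove`. For nonempty
  -- `w` this contradicts the minimality of `u`. For empty `w` it leaves both prefixes with a single
  -- letter, which was normalised to 1. One prefix cannot properly extend the other, again by
  -- minimality.
  prefix-unique : ∀ w {v v′} → u ≡ w ++ v → u′ ≡ w ++ v′ → v ≡ v′
  prefix-unique w {[]}    {[]}    _ _ = refl
  prefix-unique w {[]}    {y ∷ _} eq refl with trans eq (List.++-identityʳ w)
  ... | refl = contradiction (proj₁ (proj₂ (proj₂ (proj₂ D)))) (𝒟-minimal D′ 1≤u)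
  prefix-unique w {x ∷ _} {[]}    refl eq with trans eq (List.++-identityʳ w)
  ... | refl = contradiction (proj₁ (proj₂ (proj₂ (proj₂ D′)))) (𝒟-minimal D 1≤u′)
  prefix-unique w {x ∷ v} {y ∷ v′} eq eq′ with x Defs.≟ y
  ... | yes refl = cong (x ∷_) (prefix-unique (w ∷ʳ x)
    (trans eq (sym (List.∷ʳ-++ w x v))) (trans eq′ (sym (List.∷ʳ-++ w x v′))))
  ... | no x≢y = contradiction x≢y (differ w eq eq′)
    where
    periodic-rest : ∀ {w x v y i u z} → 𝒟 i n u → u ++ z ↭ range n → u ≡ w ++ x ∷ v →
      y ∈ complement n w → x ≢ y → remove x (complement n w) ≲ remove y (complement n w) →
      Periodic (complement n w) × Periodic (complement n (w ∷ʳ x))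
    periodic-rest {w} {x} {v} {y} {z = z} D p refl y∈ x≢y le =
      let _ , _ , _ , prog , prog′ = ≲-remove (complement-Sorted n w) y∈ x≢y le in
      Progression⇒Periodic (subst (2 ≤_) (Perm.↭-length q) (ℕ.m≤n⇒m≤1+n 2≤vz)) prog ,
      subst Periodic (sym (complement-∷ʳ n w x))
        (Progression⇒Periodic
          (subst (2 ≤_) (trans (Perm.↭-length q′) (cong length (complement-∷ʳ n w x))) 2≤vz)
          prog′)
      where
      q : x ∷ v ++ z ↭ complement n w
      q = ↭-complement w (↭-trans (↭-reflexive (sym (List.++-assoc w (x ∷ v) z))) p)
      q′ : v ++ z ↭ complement n (w ∷ʳ x)
      q′ = ↭-complement (w ∷ʳ x) (↭-trans (↭-reflexive
        (trans (List.∷ʳ-++ w x (v ++ z)) (sym (List.++-assoc w (x ∷ v) z)))) p)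
      2≤vz : 2 ≤ length (v ++ z)
      2≤vz = subst (2 ≤_) (sym (List.length-++ v)) (ℕ.≤-trans (2≤∣_∣ D p) (ℕ.m≤n+m _ (length v)))

    ∈-complement : ∀ {w y v u z} → u ++ z ↭ range n → u ≡ w ++ y ∷ v → y ∈ complement n w
    ∈-complement {w} {y} {v} {z = z} p refl = Perm.∈-resp-↭
      (↭-complement w (↭-trans (↭-reflexive (sym (List.++-assoc w (y ∷ v) z))) p)) (here refl)

    singleton : ∀ {i u x v} → 𝒟 i n u → (length u ≡ 1 → u ≡ letter 0 ∷ []) → u ≡ x ∷ v →
      Periodic (complement n (x ∷ [])) → x ≡ letter 0
    singleton {v = []}    D norm refl _   = List.∷-injectiveˡ (norm refl)
    singleton {v = _ ∷ _} D norm refl per = contradiction per (𝒟-minimal D (s≤s z≤n))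

    differ : ∀ w → u ≡ w ++ x ∷ v → u′ ≡ w ++ y ∷ v′ → ¬ x ≢ y
    differ []      eq eq′ x≢y = contradiction
      (trans (singleton D norm eq (proj₂ (periodic-rest D p eq (∈-complement p′ eq′) x≢y
               (proj₁ (suffix-≲ [] eq eq′)))))
        (sym (singleton D′ norm′ eq′ (proj₂ (periodic-rest D′ p′ eq′ (∈-complement p eq) (x≢y ∘ sym)
               (proj₂ (suffix-≲ [] eq eq′)))))))
      x≢y
    differ w@(_ ∷ _) eq eq′ x≢y = contradiction
      (proj₁ (periodic-rest D p eq (∈-complement p′ eq′) x≢y (proj₁ (suffix-≲ w eq eq′))))
      (𝒟-minimal (subst (𝒟 i n) eq D) (s≤s z≤n))

-- Scaling

+-*-regroup : ∀ a a′ δ x c → a + x * δ + (a′ + c * δ) ≡ a + a′ + (x + c) * δ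
+-*-regroup = solve-∀

+-*-regroup₂ : ∀ a δ c d x y →
  2 + a + a + c + d + (x + y) * δ ≡ suc (a + x * δ) + c + (suc (a + y * δ) + d)
+-*-regroup₂ = solve-∀

scale : ℕ → ℕ → ℙ → ℙ
scale a δ x = letter (a + (value x ∸ 1) * δ)

scale-≲⁺ : ∀ a a′ δ {R R′} → R ≲ R′ → map (scale a δ) R ≲ map (scale a′ δ) R′
-- The shift is multiplied by `δ`; the two offsets are added crosswise so that they cancel.
scale-≲⁺ a a′ δ {R} {R′} (c , d , f) = a′ + c * δ , a + d * δ , image
  where
  image : ∀ {z} → z ∈ map (scale a δ) R →
    ∃[ z′ ] z′ ∈ map (scale a′ δ) R′ × value z + (a′ + c * δ) ≡ value z′ + (a + d * δ)
  image z∈ with x , x∈ , refl ← ∈-map⁻ (scale a δ) z∈ =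
    let y , y∈ , e = f x∈ in
    scale a′ δ y , ∈-map⁺ (scale a′ δ) y∈ ,
    cong suc (calc (value x ∸ 1) (value y ∸ 1) (ℕ.suc-injective
      (trans (cong (_+ c) (sym (value-suc x))) (trans e (cong (_+ d) (value-suc y))))))
    where
    calc : ∀ x y → x + c ≡ y + d → a + x * δ + (a′ + c * δ) ≡ a′ + y * δ + (a + d * δ)
    calc x y e = begin
      a + x * δ + (a′ + c * δ)   ≡⟨ +-*-regroup a a′ δ x c ⟩
      a + a′ + (x + c) * δ       ≡⟨ cong₂ (λ b k → b + k * δ) (ℕ.+-comm a a′) e ⟩
      a′ + a + (y + d) * δ       ≡⟨ +-*-regroup a′ a δ y d ⟨
      a′ + y * δ + (a + d * δ)   ∎
      where open ≡-Reasoning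

-- A single pair `x₀ ↦ y₀` determines the shift, which is `y₀ - x₀`. Combining its equation with
-- that of another pair eliminates `a`, `c` and `d`, and the factor `δ` cancels.
scale-≲⁻ : ∀ a δ {R R′} → 0 < δ → map (scale a δ) R ≲ map (scale a δ) R′ → R ≲ R′
scale-≲⁻ a δ {[]}     0<δ _ = 0 , 0 , λ ()
scale-≲⁻ a δ {x₀ ∷ R} {R′} 0<δ (c , d , f)
  with w₀ , w₀∈ , e₀ ← f (here refl)
  with y₀ , _ , refl ← ∈-map⁻ (scale a δ) w₀∈ = value y₀ , value x₀ , image
  where
  calc : ∀ x y x₀ y₀ → suc (a + x * δ) + c ≡ suc (a + y * δ) + d →
    suc (a + x₀ * δ) + c ≡ suc (a + y₀ * δ) + d → x + y₀ ≡ y + x₀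
  calc x y x₀ y₀ e e₀ = ℕ.*-cancelʳ-≡ (x + y₀) (y + x₀) δ {{>-nonZero 0<δ}}
    (ℕ.+-cancelˡ-≡ (2 + a + a + c + d) _ _ (begin
      2 + a + a + c + d + (x + y₀) * δ               ≡⟨ +-*-regroup₂ a δ c d x y₀ ⟩
      suc (a + x * δ) + c + (suc (a + y₀ * δ) + d)   ≡⟨ cong₂ _+_ e (sym e₀) ⟩
      suc (a + y * δ) + d + (suc (a + x₀ * δ) + c)   ≡⟨ +-*-regroup₂ a δ d c y x₀ ⟨
      2 + a + a + d + c + (y + x₀) * δ               ≡⟨ cong (_+ (y + x₀) * δ) (+-swapʳ (2 + a + a) d c) ⟩
      2 + a + a + c + d + (y + x₀) * δ               ∎))
    where
    open ≡-Reasoning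
    +-swapʳ : ∀ k m n → k + m + n ≡ k + n + m
    +-swapʳ k m n = trans (ℕ.+-assoc k m n)
      (trans (cong (k +_) (ℕ.+-comm m n)) (sym (ℕ.+-assoc k n m)))
  image : ∀ {x} → x ∈ x₀ ∷ R → ∃[ y ] y ∈ R′ × value x + value y₀ ≡ value y + value x₀
  image {x} x∈ with f (∈-map⁺ (scale a δ) x∈)
  ... | w , w∈ , e with ∈-map⁻ (scale a δ) w∈
  ... | y , y∈ , refl = y , y∈ , (begin
    value x + value y₀                            ≡⟨ cong₂ _+_ (value-suc x) (value-suc y₀) ⟩
    suc (value x ∸ 1) + suc (value y₀ ∸ 1)        ≡⟨ cong suc (ℕ.+-suc _ _) ⟩
    2 + (value x ∸ 1 + (value y₀ ∸ 1))            ≡⟨ cong (2 +_)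
      (calc (value x ∸ 1) (value y ∸ 1) (value x₀ ∸ 1) (value y₀ ∸ 1) e e₀) ⟩
    2 + (value y ∸ 1 + (value x₀ ∸ 1))            ≡⟨ cong suc (ℕ.+-suc _ _) ⟨
    suc (value y ∸ 1) + suc (value x₀ ∸ 1)        ≡⟨ cong₂ _+_ (value-suc y) (value-suc x₀) ⟨
    value y + value x₀                            ∎)
    where open ≡-Reasoning

scale-≈⁺ : ∀ a a′ δ {r r′} → r ≈ r′ → map (scale a δ) r ≈ map (scale a′ δ) r′
scale-≈⁺ a a′ δ {r} {r′} e i =
  subst₂ (λ A B → A ≲ B × B ≲ A) (sym (List.drop-map i r)) (sym (List.drop-map i r′))
    (scale-≲⁺ a a′ δ (proj₁ (e i)) , scale-≲⁺ a′ a δ (proj₂ (e i)))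

scale-≈⁻ : ∀ a δ {r r′} → 0 < δ → map (scale a δ) r ≈ map (scale a δ) r′ → r ≈ r′
scale-≈⁻ a δ {r} {r′} 0<δ e i =
  let e₁ , e₂ = subst₂ (λ A B → A ≲ B × B ≲ A) (List.drop-map i r) (List.drop-map i r′) (e i)
  in scale-≲⁻ a δ 0<δ e₁ , scale-≲⁻ a δ 0<δ e₂

Progression⇒scale : ∀ {a δ S} → Progression a δ S → map (scale a δ) (range (length S)) ≡ S
Progression⇒scale {a} {δ} {S} prog = ex-ext _ S lengths λ {k} k< →
  let k<S = subst (k <_) lengths k<
  in trans (trans (cong (λ w → ex w k) as-word) (ex-word (λ k → a + k * δ) k<S)) (sym (prog k<S))
  where
  lengths : length (map (scale a δ) (range (length S))) ≡ length S
  lengths = trans (List.length-map (scale a δ) (range (length S))) (length-range (length S))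
  as-word : map (scale a δ) (range (length S)) ≡ word (λ k → a + k * δ) (length S)
  as-word = trans (sym (List.map-∘ (upTo (length S))))
    (List.map-upTo (scale a δ ∘ letter) (length S))

≈-∷ : ∀ {x y t t′} → x ∷ t ⊆ y ∷ t′ → y ∷ t′ ⊆ x ∷ t → t ≈ t′ → x ∷ t ≈ y ∷ t′
≈-∷ sub sup e zero    = ⊆⇒≲ sub , ⊆⇒≲ sup
≈-∷ sub sup e (suc i) = e i

-- Suffixes that start inside `u` have the same letters on both sides because of `z ↭ z′`; the
-- others are suffixes of `z` and `z′`.
≈-++⁺ : ∀ u {z z′} → z ↭ z′ → z ≈ z′ → u ++ z ≈ u ++ z′
≈-++⁺ []      p e = e
≈-++⁺ (x ∷ u) p e = ≈-∷ (Perm.∈-resp-↭ q) (Perm.∈-resp-↭ (↭-sym q)) (≈-++⁺ u p e)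
  where q = Perm.++⁺ˡ (x ∷ u) p

≈-++⁻ : ∀ u {z z′} → u ++ z ≈ u ++ z′ → z ≈ z′
≈-++⁻ u e i = subst₂ (λ A B → A ≲ B × B ≲ A) (drop-++ u i) (drop-++ u i) (e (length u + i))

-- One of the pairs {1, 2} and {3, 4} avoids x.
step-complement-[x] : ∀ {n x} → 4 ≤ n → Periodic (complement n (x ∷ [])) →
  step (complement n (x ∷ [])) ≡ 1
step-complement-[x] {n} {x} 4≤n per = by-cases (value x ℕ.≤? 2)
  where
  A = complement n (x ∷ [])
  prog = proj₂ (Periodic⇒Progression (complement-Sorted n (x ∷ [])) per)

  ∈A : ∀ s → suc s ≤ n → letter s ≢ x → letter s ∈ A
  ∈A s s<n s≢x = ∈-filter⁺ (_∉? (x ∷ [])) (∈-range⁺ (letter s) s<n) λ { (here e) → s≢x e }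

  adjacent : ∀ s → 2 + s ≤ n → letter s ≢ x → letter (suc s) ≢ x → step A ≡ 1
  adjacent s s+2≤n s≢x s′≢x =
    let k , _ , e   = Progression-∈ prog (∈A s (ℕ.<⇒≤ s+2≤n) s≢x)
        k′ , _ , e′ = Progression-∈ prog (∈A (suc s) s+2≤n s′≢x)
    -- Two consecutive integers in a progression differ by a multiple of its step, so the step
    -- divides 1.
    in ℕ.m*n≡1⇒n≡1 (k′ ∸ k) (step A) (begin
      (k′ ∸ k) * step A                  ≡⟨ ℕ.*-distribʳ-∸ (step A) k′ k ⟩
      k′ * step A ∸ k * step A           ≡⟨ cong (_∸ k * step A) (ℕ.+-cancelˡ-≡ (start A) _ _
        (trans (sym (ℕ.suc-injective e′)) (trans e (sym (ℕ.+-suc (start A) _))))) ⟩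
      suc (k * step A) ∸ k * step A      ≡⟨ ℕ.m+n∸n≡m 1 (k * step A) ⟩
      1                                  ∎)
    where open ≡-Reasoning

  by-cases : Dec (value x ≤ 2) → step A ≡ 1
  by-cases (yes x≤2) = adjacent 2 4≤n
    (λ e → ℕ.<⇒≱ (ℕ.n<1+n 2) (subst (_≤ 2) (cong value (sym e)) x≤2))
    (λ e → ℕ.<⇒≱ (ℕ.m≤n⇒m≤1+n (ℕ.n<1+n 2)) (subst (_≤ 2) (cong value (sym e)) x≤2))
  by-cases (no x≰2)  = adjacent 0 (ℕ.≤-trans (s≤s (s≤s z≤n)) 4≤n)
    (λ e → x≰2 (subst (_≤ 2) (cong value e) (s≤s z≤n)))
    (λ e → x≰2 (subst (_≤ 2) (cong value e) ℕ.≤-refl))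

-- Transversals

-- The entries stand for inverses of permutations. The representatives themselves are kept, not only
-- their number, because larger transversals are glued from smaller ones.
record Transversal (n : ℕ) : Set where
  field
    reps        : List ℙ*
    reps-↭      : ∀ {r} → r ∈ reps → r ↭ range n
    reps-Unique : Unique reps
    separated   : ∀ {r r′} → r ∈ reps → r′ ∈ reps → r ≈ r′ → r ≡ r′
    complete    : ∀ {t} → t ↭ range n → ∃[ r ] r ∈ reps × t ≈ r

  size : ℕ
  size = length reps

open Transversal

lookup-injective : {xs : List X} → Unique xs → ∀ i j → lookup xs i ≡ lookup xs j → i ≡ j
lookup-injective (_ ∷ _)    zero    zero    _ = refl
lookup-injective (x∉ ∷ _)   zero    (suc j) e = contradiction e (All.lookup x∉ (∈-lookup j))
lookup-injective (x∉ ∷ _)   (suc i) zero    e = contradiction (sym e) (All.lookup x∉ (∈-lookup i))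
lookup-injective (_ ∷ uniq) (suc i) (suc j) e = cong suc (lookup-injective uniq i j e)

-- Inversion is an involution of the permutations that turns `~ss` into `≈`; a permutation is sent
-- to the rank of the representative of its inverse.
Transversal⇒NumberOfClasses : ∀ {n} (T : Transversal n) → NumberOfClasses n (size T)
Transversal⇒NumberOfClasses {n} T = record
  { to        = rank
  ; cong      = λ {x} {y} e → rank-unique y (rank x) (≈-trans (≈-sym (to-≈ x y e)) (rank-≈ x))
  ; bijective = (λ {x} {y} e → from-≈ x y (≈-trans (rank-≈ x)
                  (subst (λ i → lookup (reps T) i ≈ inv n (proj₁ y)) (sym e) (≈-sym (rank-≈ y)))))
              , λ k → word′ k , λ {z} e →
                  sym (rank-unique z k (≈-trans (to-≈ z (word′ k) e) (inverse k)))
  }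
  where

  class : ((w , p) : 𝒮 n) → ∃[ r ] r ∈ reps T × inv n w ≈ r
  class (w , p) = complete T (inv-↭ p)

  rank : 𝒮 n → Fin (size T)
  rank x = Any.index (proj₁ (proj₂ (class x)))

  rank-≈ : ∀ x → inv n (proj₁ x) ≈ lookup (reps T) (rank x)
  rank-≈ x = let _ , r∈ , e = class x in subst (inv n (proj₁ x) ≈_) (Any.lookup-index r∈) e

  rank-unique : ∀ x i → inv n (proj₁ x) ≈ lookup (reps T) i → i ≡ rank x
  rank-unique x i e = lookup-injective (reps-Unique T) i (rank x)
    (separated T (∈-lookup i) (∈-lookup (rank x)) (≈-trans (≈-sym e) (rank-≈ x)))

  to-≈ : (x y : 𝒮 n) → proj₁ x ~ss proj₁ y → inv n (proj₁ x) ≈ inv n (proj₁ y)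
  to-≈ (w , p) (w′ , p′) e = ~ss⇒≈ (inv-↭ p) (inv-↭ p′)
    (subst₂ _~ss_ (sym (inv-inv p)) (sym (inv-inv p′)) e)

  from-≈ : (x y : 𝒮 n) → inv n (proj₁ x) ≈ inv n (proj₁ y) → proj₁ x ~ss proj₁ y
  from-≈ (w , p) (w′ , p′) e = subst₂ _~ss_ (inv-inv p) (inv-inv p′)
    (≈⇒~ss (inv-↭ p) (inv-↭ p′) e)

  word′ : Fin (size T) → 𝒮 n
  word′ k = inv n (lookup (reps T) k) , inv-↭ (reps-↭ T (∈-lookup k))

  inverse : ∀ k → inv n (inv n (lookup (reps T) k)) ≈ lookup (reps T) k
  inverse k = subst (_≈ lookup (reps T) k) (sym (inv-inv (reps-↭ T (∈-lookup k)))) ≈-refl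

-- At most three letters

-- A decidable sufficient condition for `≲`: only `c` and `d` below `n` are searched. It serves to
-- confirm equivalences, never to refute them.
Shifted : ℕ → ℙ* → ℙ* → Set
Shifted n A B = Any (λ (c , d) → All (λ x → Any (λ y → value x + c ≡ value y + d) B) A)
  (cartesianProduct (upTo n) (upTo n))

shifted? : ∀ n A B → Dec (Shifted n A B)
shifted? n A B = Any.any?
  (λ (c , d) → All.all? (λ x → Any.any? (λ y → value x + c ℕ.≟ value y + d) B) A) _

Shifted⇒≲ : ∀ n {A B} → Shifted n A B → A ≲ B
Shifted⇒≲ n {A} {B} s = let (c , d) , all = Any.satisfied s in c , d , λ x∈ → find (All.lookup all x∈)

Close : ℕ → ℙ* → ℙ* → Set
Close n t r = All (λ i → Shifted n (drop i t) (drop i r) × Shifted n (drop i r) (drop i t)) (upTo n)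

close? : ∀ n t r → Dec (Close n t r)
close? n t r = All.all?
  (λ i → shifted? n (drop i t) (drop i r) ×-dec shifted? n (drop i r) (drop i t)) (upTo n)

Close⇒≈ : ∀ {n t r} → length t ≡ n → length r ≡ n → Close n t r → t ≈ r
Close⇒≈ {n} {t} {r} lt lr close i with i ℕ.<? n
... | yes i<n = let s , s′ = All.lookup close (∈-upTo⁺ i<n) in Shifted⇒≲ n s , Shifted⇒≲ n s′
... | no  i≮n = empty t lt , empty r lr
  where
  empty : ∀ t {B} → length t ≡ n → drop i t ≲ B
  empty t lt rewrite List.drop-all i t (ℕ.≤-trans (ℕ.≤-reflexive lt) (ℕ.≮⇒≥ i≮n)) = 0 , 0 , λ ()

module _ (n : ℕ) (rs : List ℙ*) (rs-↭ : All (_↭ range n) rs) where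

  covered? : Dec (All (λ t → Unique t → Any (Close n t) rs) (words n n))
  covered? = All.all?
    (λ t → AllPairs.allPairs? (λ x y → ¬? (x Defs.≟ y)) t →-dec Any.any? (close? n t) rs)
    (words n n)

  -- `covered?` evaluates over all words of length `n`, so completeness for a concrete `n` is
  -- settled by computation.
  Close-complete : True covered? → ∀ {t} → t ↭ range n → ∃[ r ] r ∈ rs × t ≈ r
  Close-complete covered {t} p =
    let r , r∈ , close = find (All.lookup (toWitness covered) t∈ (↭-Unique p))
    in r , r∈ , Close⇒≈ (↭-length-range p) (↭-length-range (All.lookup rs-↭ r∈)) close
    where
    t∈ : t ∈ words n n
    t∈ = subst (λ i → t ∈ words i n) (↭-length-range p)
      (∈-words⁺ t (All.tabulate (Perm.∈-resp-↭ p)))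

singleton-transversal : ∀ n → True (covered? n (range n ∷ []) (↭-refl ∷ [])) → Transversal n
singleton-transversal n covered = record
  { reps        = range n ∷ []
  ; reps-↭      = λ { (here refl) → ↭-refl }
  ; reps-Unique = [] ∷ []
  ; separated   = λ { (here refl) (here refl) _ → refl }
  ; complete    = Close-complete n (range n ∷ []) (↭-refl ∷ []) covered
  }

transversal₃ : Transversal 3
transversal₃ = record
  { reps        = t₁ ∷ t₂ ∷ []
  ; reps-↭      = All.lookup perms
  ; reps-Unique = ((λ ()) ∷ []) ∷ [] ∷ []
  ; separated   = λ
      { (here refl)         (here refl)         _ → refl
      ; (here refl)         (there (here refl)) e → contradiction e t₁≉t₂
      ; (there (here refl)) (here refl)         e → contradiction (≈-sym {t₂} {t₁} e) t₁≉t₂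
      ; (there (here refl)) (there (here refl)) _ → refl
      }
  ; complete    = Close-complete 3 (t₁ ∷ t₂ ∷ []) perms _
  }
  where
  t₁ t₂ : ℙ*
  t₁ = letter 0 ∷ letter 1 ∷ letter 2 ∷ []
  t₂ = letter 1 ∷ letter 0 ∷ letter 2 ∷ []

  perms : All (_↭ range 3) (t₁ ∷ t₂ ∷ [])
  perms = ↭-refl ∷ Perm.swap _ _ ↭-refl ∷ []

  t₁≉t₂ : ¬ t₁ ≈ t₂
  -- After the first letter the sets are {2, 3} and {1, 3}, whose gaps are 1 and 2. Each choice of
  -- images for 2 and 3 gives a false equation.
  t₁≉t₂ e with e 1
  ... | (c , d , f) , _ with f (here refl) | f (there (here refl))
  ... | _ , here refl , e₁         | _ , here refl , e₂ =
    contradiction (ℕ.+-cancelʳ-≡ c 2 3 (trans e₁ (sym e₂))) λ ()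
  ... | _ , here refl , e₁         | _ , there (here refl) , e₂ =
    contradiction (trans (sym (cong suc e₁)) e₂) (λ e → contradiction (ℕ.+-cancelʳ-≡ d 2 3 e) λ ())
  ... | _ , there (here refl) , e₁ | _ , here refl , e₂ =
    contradiction (trans (sym (cong suc e₁)) e₂) (λ e → contradiction (ℕ.+-cancelʳ-≡ d 4 1 e) λ ())
  ... | _ , there (here refl) , e₁ | _ , there (here refl) , e₂ =
    contradiction (ℕ.+-cancelʳ-≡ c 2 3 (trans e₁ (sym e₂))) λ ()

-- The recursive construction

least : ∀ {P : Pred ℕ 0ℓ} → Decidable P → ∀ m → P m → ∃[ k ] k ≤ m × P k × (∀ {j} → j < k → ¬ P j)
least P? zero    Pm = 0 , z≤n , Pm , λ ()
least P? (suc m) Pm with P? 0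
... | yes P0 = 0 , z≤n , P0 , λ ()
... | no ¬P0 =
  let k , k≤m , Pk , min = least (P? ∘ suc) m Pm
  in suc k , s≤s k≤m , Pk , λ { {zero} _ → ¬P0 ; {suc j} (s≤s j<k) → min j<k }

length-concat : (f : ℕ → List X) → ∀ N → length (concat (applyUpTo f N)) ≡ Sum (length ∘ f) N
length-concat f zero    = refl
length-concat f (suc N) = trans (List.length-++ (f 0))
  (cong (length (f 0) +_) (length-concat (f ∘ suc) N))

∈-concat-applyUpTo⁻ : (f : ℕ → List X) → ∀ N {x} → x ∈ concat (applyUpTo f N) → ∃[ k ] x ∈ f k
∈-concat-applyUpTo⁻ f N x∈ with ∈-concat⁻′ (applyUpTo f N) x∈
... | _ , x∈′ , block∈ with ∈-applyUpTo⁻ f block∈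
... | k , _ , refl = k , x∈′

length-cartesianProduct : (xs : List X) (ys : List Y) →
  length (cartesianProduct xs ys) ≡ length xs * length ys
length-cartesianProduct []       ys = refl
length-cartesianProduct (x ∷ xs) ys = trans (List.length-++ (map (x ,_) ys))
  (cong₂ _+_ (List.length-map (x ,_) ys) (length-cartesianProduct xs ys))

-- For a progression `A` with `k` terms, the increasing bijection from `[k]` onto `A`, applied
-- letter by letter.
place : List ℙ → ℙ* → ℙ*
place A = map (scale (start A) (step A))

module _ (m : ℕ) (T : ∀ {k} → k < 4 + m → Transversal k) where

  private
    n = 4 + m

  -- For n ≥ 4, [n] ∖ {x} is periodic only if it is an interval.  The prefixes x = 1
  -- and x = n then give the same classes, and only the first is kept.
  prefixes : ℕ → List ℙ*
  prefixes zero    = (letter 0 ∷ []) ∷ []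
  prefixes (suc k) = filter (𝒟? (2 + k) n) (words (2 + k) n)

  -- Words in `prefixes k` have `suc k` letters and leave `n ∸ suc k` letters to arrange.
  rest : ∀ k → Transversal (n ∸ suc k)
  rest k = T (s≤s (ℕ.m∸n≤m (3 + m) k))

  pairsOf : ℕ → List (ℙ* × ℙ*)
  pairsOf k = cartesianProduct (prefixes k) (reps (rest k))

  pairs : List (ℙ* × ℙ*)
  pairs = concat (applyUpTo pairsOf (2 + m))

  glue : ℙ* × ℙ* → ℙ*
  glue (u , r) = u ++ place (complement n u) r

  prefix-𝒟 : ∀ k {u} → u ∈ prefixes k → 𝒟 (suc k) n u
  prefix-𝒟 (suc k) u∈ = proj₂ (∈-filter⁻ (𝒟? (2 + k) n) {xs = words (2 + k) n} u∈)
  prefix-𝒟 zero (here refl) =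
    refl , ∈-range⁺ (letter 0) (s≤s z≤n) ∷ [] , [] ∷ [] , periodic , λ { (s≤s z≤n) () }
    where
    complement≡ : complement n (letter 0 ∷ []) ≡ word suc (3 + m)
    complement≡ = trans
      (List.filter-all (_∉? (letter 0 ∷ []))
        (All.map⁺ (All.applyUpTo⁺₂ suc (3 + m) λ { _ (here ()) })))
      (List.map-applyUpTo suc letter (3 + m))
    progression : Progression 1 1 (word suc (3 + m))
    progression {k} k< = trans (ex-word suc (subst (k <_) (length-word suc (3 + m)) k<))
      (cong suc (sym (ℕ.*-identityʳ k)))
    periodic : Periodic (complement n (letter 0 ∷ []))
    periodic = subst Periodic (sym complement≡) (Progression⇒Periodic (s≤s (s≤s z≤n)) progression)

  prefix-norm : ∀ k {u} → u ∈ prefixes k → length u ≡ 1 → u ≡ letter 0 ∷ []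
  prefix-norm zero    (here refl) _   = refl
  prefix-norm (suc k) u∈          len =
    contradiction (trans (sym (proj₁ (prefix-𝒟 (suc k) u∈))) len) λ ()

  module Complement {k u} (D : 𝒟 (suc k) n u) where

    A = complement n u

    u++A↭ : u ++ A ↭ range n
    u++A↭ = ++-complement (proj₁ (proj₂ (proj₂ D))) (proj₁ (proj₂ D))

    length-A : length A ≡ n ∸ suc k
    length-A = sym (begin
      n ∸ suc k                       ≡⟨ cong₂ _∸_ (↭-length-range u++A↭) (proj₁ D) ⟨
      length (u ++ A) ∸ length u      ≡⟨ cong (_∸ length u) (List.length-++ u) ⟩
      length u + length A ∸ length u  ≡⟨ ℕ.m+n∸m≡n (length u) _ ⟩
      length A                        ∎)
      where open ≡-Reasoning

    progression : 0 < step A × Progression (start A) (step A) A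
    progression = Periodic⇒Progression (complement-Sorted n u) (proj₁ (proj₂ (proj₂ (proj₂ D))))

    place-range : place A (range (n ∸ suc k)) ≡ A
    place-range = subst (λ l → place A (range l) ≡ A) length-A
      (Progression⇒scale (proj₂ progression))

    place-↭ : ∀ {r} → r ↭ range (n ∸ suc k) → place A r ↭ A
    place-↭ p = ↭-trans (Perm.map⁺ (scale (start A) (step A)) p) (↭-reflexive place-range)

    glue-↭ : ∀ {r} → r ↭ range (n ∸ suc k) → u ++ place A r ↭ range n
    glue-↭ p = ↭-trans (Perm.++⁺ˡ u (place-↭ p)) u++A↭

    place-inv : ∀ {z} → z ↭ A → ∃[ r ] z ≡ place A r × r ↭ range (n ∸ suc k)
    place-inv p =
      let r , e , q = Perm.↭-map-inv (scale (start A) (step A))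
                        (↭-trans (↭-reflexive place-range) (↭-sym p))
      in r , e , ↭-sym q

  open Complement

  ∈-pairs⁻ : ∀ {u r} → (u , r) ∈ pairs → ∃[ k ] u ∈ prefixes k × r ∈ reps (rest k)
  ∈-pairs⁻ ur∈ =
    let k , ur∈′ = ∈-concat-applyUpTo⁻ pairsOf (2 + m) ur∈
    in k , ∈-cartesianProduct⁻ (prefixes k) (reps (rest k)) ur∈′

  ∈-pairs⁺ : ∀ {k u r} → k < 2 + m → u ∈ prefixes k → r ∈ reps (rest k) → (u , r) ∈ pairs
  ∈-pairs⁺ k< u∈ r∈ = ∈-concat⁺′ (∈-cartesianProduct⁺ u∈ r∈) (∈-applyUpTo⁺ pairsOf k<)

  glue-injective : ∀ k k′ {u u′ r r′} → u ∈ prefixes k → u′ ∈ prefixes k′ →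
    r ∈ reps (rest k) → r′ ∈ reps (rest k′) → u ≡ u′ → k ≡ k′ →
    glue (u , r) ≈ glue (u′ , r′) → (u , r) ≡ (u′ , r′)
  glue-injective k _ {u} u∈ _ r∈ r′∈ refl refl e = cong (u ,_) (separated (rest k) r∈ r′∈
    (scale-≈⁻ (start (A D)) (step (A D)) (proj₁ (progression D)) (≈-++⁻ u e)))
    where D = prefix-𝒟 k u∈

  glue-separated : ∀ {a b} → a ∈ pairs → b ∈ pairs → glue a ≈ glue b → a ≡ b
  glue-separated {u , r} {u′ , r′} a∈ b∈ e =
    let k  , u∈  , r∈  = ∈-pairs⁻ a∈
        k′ , u′∈ , r′∈ = ∈-pairs⁻ b∈
        D  = prefix-𝒟 k u∈
        D′ = prefix-𝒟 k′ u′∈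
        u≡u′ = prefix-unique D D′
          (glue-↭ D (reps-↭ (rest k) r∈)) (glue-↭ D′ (reps-↭ (rest k′) r′∈))
          (prefix-norm k u∈) (prefix-norm k′ u′∈)
          (subst (1 ≤_) (sym (proj₁ D)) (s≤s z≤n)) (subst (1 ≤_) (sym (proj₁ D′)) (s≤s z≤n))
          e [] refl refl
    in glue-injective k k′ u∈ u′∈ r∈ r′∈ u≡u′
         (ℕ.suc-injective (trans (sym (proj₁ D)) (trans (cong length u≡u′) (proj₁ D′)))) e

  pairs-Unique : Unique pairs
  pairs-Unique = Unique.concat⁺
    (All.applyUpTo⁺₂ pairsOf (2 + m) λ k →
      Unique.cartesianProduct⁺ (prefixes-Unique k) (reps-Unique (rest k)))
    (AllPairs.applyUpTo⁺₁ pairsOf (2 + m) λ i<j _ → disjoint i<j)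
    where
    prefixes-Unique : ∀ k → Unique (prefixes k)
    prefixes-Unique zero    = [] ∷ []
    prefixes-Unique (suc k) = Unique.filter⁺ (𝒟? (2 + k) n) (words-Unique (2 + k) n)
    disjoint : ∀ {i j} → i < j → Disjoint (pairsOf i) (pairsOf j)
    disjoint {i} {j} i<j (p , q) = ℕ.<⇒≢ (s≤s i<j) (trans
      (sym (proj₁ (prefix-𝒟 i (proj₁ (∈-cartesianProduct⁻ (prefixes i) (reps (rest i)) p)))))
      (proj₁ (prefix-𝒟 j (proj₁ (∈-cartesianProduct⁻ (prefixes j) (reps (rest j)) q)))))

  place-≈ : ∀ A A′ {r r′} → step A ≡ step A′ → r ≈ r′ → place A r ≈ place A′ r′
  place-≈ A A′ {r} {r′} eq e = subst (λ δ → place A r ≈ map (scale (start A′) δ) r′) eq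
    (scale-≈⁺ (start A) (start A′) (step A) e)

  -- Only one-letter prefixes change. Their complements are progressions of step 1, as is that of
  -- the prefix 1, and the class of a placed word depends on the step but not on the start.
  normalise : ∀ k {u r r′} → 𝒟 (suc k) n u → r ↭ range (n ∸ suc k) → r′ ∈ reps (rest k) → r ≈ r′ →
    ∃[ v ] v ∈ prefixes k × glue (u , r) ≈ glue (v , r′)
  normalise zero {x ∷ []} D@(_ , _ , _ , per , _) q r′∈ e =
    letter 0 ∷ [] , here refl , ≈-∷ (Perm.∈-resp-↭ same) (Perm.∈-resp-↭ (↭-sym same))
      (place-≈ (A D) (A D₀) (trans (step-complement-[x] {x = x} 4≤n per)
                                   (sym (step-complement-[x] {x = letter 0} 4≤n per₀))) e)
    where
    4≤n : 4 ≤ n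
    4≤n = ℕ.m≤m+n 4 m
    D₀ = prefix-𝒟 0 (here refl)
    per₀ = proj₁ (proj₂ (proj₂ (proj₂ D₀)))
    same = ↭-trans (glue-↭ D q) (↭-sym (glue-↭ D₀ (reps-↭ (rest 0) r′∈)))
  normalise (suc k) {u} D q r′∈ e =
    u , ∈-filter⁺ (𝒟? (2 + k) n) u∈ D ,
    ≈-++⁺ u (↭-trans (place-↭ D q) (↭-sym (place-↭ D (reps-↭ (rest (suc k)) r′∈))))
      (place-≈ (A D) (A D) refl e)
    where
    u∈ : u ∈ words (2 + k) n
    u∈ = subst (λ i → u ∈ words i n) (proj₁ D) (∈-words⁺ u (proj₁ (proj₂ D)))

  module _ {t} (p : t ↭ range n) where

    private
      -- `P k` concerns the prefix of `suc k` letters, since the complement `[n]` of the empty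
      -- prefix is periodic and must not end the search.
      P : Pred ℕ 0ℓ
      P k = Periodic (complement n (take (suc k) t))

      split : ∀ i → take i t ++ drop i t ↭ range n
      split i = ↭-trans (↭-reflexive (List.take++drop≡id i t)) p

      -- Any two-element set is periodic, so the search for the first periodic complement ends after
      -- at most `n ∸ 2` letters.
      two-left : P (suc m)
      two-left = pair (trans (sym (Perm.↭-length (↭-complement (take (2 + m) t) (split (2 + m)))))
        (trans (List.length-drop (2 + m) t)
          (trans (cong (_∸ (2 + m)) (↭-length-range p)) (ℕ.m+n∸n≡m 2 (2 + m)))))
        where
        pair : ∀ {A} → length A ≡ 2 → Periodic A
        pair {_ ∷ _ ∷ []} refl = s≤s (s≤s z≤n) , [] ∷ []

      take-𝒟 : ∀ k → k ≤ suc m → P k → (∀ {j} → j < k → ¬ P j) → 𝒟 (suc k) n (take (suc k) t)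
      take-𝒟 k k≤ per min =
        trans (List.length-take (suc k) t) (ℕ.m≤n⇒m⊓n≡m
          (subst (suc k ≤_) (sym (↭-length-range p)) (s≤s (ℕ.≤-trans k≤ (ℕ.m≤n+m (suc m) 2))))) ,
        proj₂ (↭-prefix (take (suc k) t) (split (suc k))) ,
        proj₁ (↭-prefix (take (suc k) t) (split (suc k))) ,
        per ,
        λ { {suc j} (s≤s j<k) _ per′ → min j<k (subst (λ w → Periodic (complement n w))
              (trans (List.take-take (suc j) (suc k) t)
                (cong (λ i → take i t) (ℕ.m≤n⇒m⊓n≡m (s≤s (ℕ.<⇒≤ j<k))))) per′) }

    -- `t` is cut at the first periodic complement; its tail, rescaled to a permutation of an
    -- initial segment, is replaced by its representative, and the prefix is normalised.
    glue-complete : ∃[ w ] w ∈ map glue pairs × t ≈ w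
    glue-complete =
      let k , k≤ , per , min = least {P} (λ k → periodic? (complement n (take (suc k) t)))
                                 (suc m) two-left
          D                  = take-𝒟 k k≤ per min
          r , z≡ , q         = place-inv D (↭-complement (take (suc k) t) (split (suc k)))
          r′ , r′∈ , e       = complete (rest k) q
          v , v∈ , e′        = normalise k D q r′∈ e
          t≡                 = trans (cong (take (suc k) t ++_) (sym z≡)) (List.take++drop≡id (suc k) t)
      in glue (v , r′) , ∈-map⁺ glue (∈-pairs⁺ (s≤s k≤) v∈ r′∈) , subst (_≈ glue (v , r′)) t≡ e′

  extend : Transversal n
  extend = record
    { reps        = map glue pairs
    ; reps-↭      = λ w∈ → perm (∈-map⁻ glue w∈)
    ; reps-Unique = Unique-map
        (λ {a} {b} a∈ b∈ e → glue-separated a∈ b∈ (subst (glue a ≈_) e ≈-refl)) pairs-Unique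
    ; separated   = λ w∈ w′∈ e → sep (∈-map⁻ glue w∈) (∈-map⁻ glue w′∈) e
    ; complete    = glue-complete
    }
    where
    perm : ∀ {w} → ∃[ a ] a ∈ pairs × w ≡ glue a → w ↭ range n
    perm ((u , r) , a∈ , refl) =
      let k , u∈ , r∈ = ∈-pairs⁻ a∈ in glue-↭ (prefix-𝒟 k u∈) (reps-↭ (rest k) r∈)
    sep : ∀ {w w′} → ∃[ a ] a ∈ pairs × w ≡ glue a → ∃[ a ] a ∈ pairs × w′ ≡ glue a →
      w ≈ w′ → w ≡ w′
    sep (_ , a∈ , refl) (_ , b∈ , refl) e = cong glue (glue-separated a∈ b∈ e)

  -- Block 0 has the single prefix 1 and contributes the size of `rest 0`; block `suc k` has
  -- `d (2 + k) n` prefixes by the definition of `d`.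
  size-extend : size extend ≡
    size (rest 0) + Sum (λ k → d (2 + k) n * size (rest (suc k))) (suc m)
  size-extend = begin
    length (map glue pairs)
      ≡⟨ List.length-map glue pairs ⟩
    length pairs
      ≡⟨ length-concat pairsOf (2 + m) ⟩
    Sum (length ∘ pairsOf) (2 + m)
      ≡⟨ Sum-cong (2 + m) (λ {k} _ → length-cartesianProduct (prefixes k) (reps (rest k))) ⟩
    1 * size (rest 0) + Sum (λ k → d (2 + k) n * size (rest (suc k))) (suc m)
      ≡⟨ cong (_+ Sum (λ k → d (2 + k) n * size (rest (suc k))) (suc m))
           (ℕ.*-identityˡ (size (rest 0))) ⟩
    size (rest 0) + Sum (λ k → d (2 + k) n * size (rest (suc k))) (suc m) ∎
    where open ≡-Reasoning

-- The recurrence for the number of classes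

transversal : ∀ n → Transversal n
transversal = <-rec Transversal step′
  where
  step′ : ∀ n → (∀ {k} → k < n → Transversal k) → Transversal n
  step′ 0 _ = singleton-transversal 0 _
  step′ 1 _ = singleton-transversal 1 _
  step′ 2 _ = singleton-transversal 2 _
  step′ 3 _ = transversal₃
  step′ (suc (suc (suc (suc m)))) T = extend m T

mainTheorem6 : Σ[ s ∈ (ℕ → ℕ) ]
    (∀ n → NumberOfClasses n (s n)) ×
    (s 1 ≡ 1 × s 2 ≡ 1 × s 3 ≡ 2) ×
    (∀ n → 4 ≤ n →
    s n ≡ s (n ∸ 1) + ∑[ 2 ⋯ n ∸ 2 ] (λ i → d i n * s (n ∸ i)))
mainTheorem6 =
  s , classes ,
  (unique (singleton-transversal 1 _) , unique (singleton-transversal 2 _) , unique transversal₃) ,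
  recurrence
  where
  s : ℕ → ℕ
  s n = size (transversal n)

  classes : ∀ n → NumberOfClasses n (s n)
  classes n = Transversal⇒NumberOfClasses (transversal n)

  -- All transversals for `n` have the same size, so `extend` can be compared with `transversal n`
  -- without unfolding the well-founded recursion.
  unique : ∀ {n} (T : Transversal n) → s n ≡ size T
  unique {n} T = NumberOfClasses-unique {n} (classes n) (Transversal⇒NumberOfClasses T)

  recurrence : ∀ n → 4 ≤ n → s n ≡ s (n ∸ 1) + ∑[ 2 ⋯ n ∸ 2 ] (λ i → d i n * s (n ∸ i))
  recurrence (suc (suc (suc (suc m)))) (s≤s (s≤s (s≤s (s≤s _)))) =
    -- For `n = 4 + m` the sum from 2 to `n ∸ 2` has `suc m` terms and computes to the one in
    -- `size-extend`.
    trans (unique (extend m (λ {k} _ → transversal k)))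
      (size-extend m (λ {k} _ → transversal k))
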